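{- Let $k > \ell \ge 0$ be integers. For every family $\mathcal{F}$ of $k$-graphs, the limit $\lim_{n\to\infty} \mathrm{ex}_{\ell}(n,\mathcal{F})/\binom{n}{k-\ell}$ exists and $\pi_{\ell}(\mathcal{F}) = \lim_{n \to \infty} \mathrm{ex}_{\ell}(n, \mathcal{F}) / \binom{n}{k-\ell}$.
   Context: A $k$-graph $H$ is a pair $(V(H),E(H))$ where $V(H)$ is a finite set and $E(H)$ is a set of $k$-subsets of $V(H)$. For $0\le \ell<k$ and an $\ell$-subset $T$ of $V(H)$, $\deg^H(T)$ is the number of $(k-\ell)$-subsets $S$ of $V(H)$ with $S\cup T\in E(H)$, and $\delta_\ell(H)=\min\{\deg^H(T): T\subseteq V(H), |T|=\ell\}$ (so $\delta_0(H)=|E(H)|$). For a (possibly infinite) family $\mathcal{F}$ of $k$-graphs, a $k$-graph is $\mathcal{F}$-free if it contains no copy of any member of $\mathcal{F}$ as a (not necessarily induced) subgraph. Let $\mathrm{ex}_\ell(n,\mathcal{F})$ be the maximum of $\delta_\ell(H)$ over all $\mathcal{F}$-free $k$-graphs $H$ on $n$ vertices (taken to be $0$ if there are none), and let $\pi_\ell(\mathcal{F})=\limsup_{n\to\infty}\mathrm{ex}_\ell(n,\mathcal{F})/\binom{n}{k-\ell}$. -}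

module Defs where

open import Axiom.ExcludedMiddle using (ExcludedMiddle)
open import Data.Bool.Base using (Bool; true; false; T)
open import Data.Bool.Properties using (T?)
open import Data.Fin.Base using (Fin)
open import Data.Fin.Properties using (any?)
import Data.Fin.Properties as Fin
open import Data.Fin.Subset using (Subset; inside; outside; _∈_; _∪_; ∣_∣)
open import Data.Fin.Subset.Properties using (_∈?_)
open import Data.Integer.Base using (+_)
import Data.Integer.Base as ℤ
import Data.Integer.Properties as ℤ
open import Data.List.Base using (List; []; _∷_; _++_; map; filter; length)
open import Data.List.Extrema.Nat using (min; min≤⊤)
open import Data.List.Properties using (length-map; length-++; filter-++; length-filter)
open import Data.List.Relation.Unary.All using (All; []; _∷_)
open import Data.List.Relation.Unary.All.Properties using (all-filter)
open import Data.Nat.Base as ℕ using (ℕ; zero; suc; _∸_; _≤_; z≤n; s≤s)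
open import Data.Nat.Combinatorics using (_C_; nCk+nC[k+1]≡[n+1]C[k+1])
open import Data.Nat.Properties using (_≟_)
import Data.Nat.Properties as ℕ
open import Data.Product.Base using (Σ; ∃; ∃-syntax; _×_; _,_; proj₁; proj₂)
open import Data.Rational.Base as ℚ using (ℚ; 0ℚ; 1ℚ; _/_; _<_)
import Data.Rational.Properties as ℚ
import Data.Rational.Unnormalised.Base as ℚᵘ
import Data.Rational.Unnormalised.Properties as ℚᵘ
open import Data.Sum.Base using (_⊎_; inj₁; inj₂)
open import Data.Vec.Base using ([]; _∷_; tabulate)
open import Function.Bundles using (_⇔_)
open import Function.Definitions using (Injective)
open import Level using (0ℓ)
open import Relation.Binary.PropositionalEquality
  using (_≡_; refl; sym; trans; cong; cong₂; subst; module ≡-Reasoning)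
open import Relation.Nullary using (¬_; does; yes; no; contradiction)
open import Relation.Nullary.Decidable using (_×-dec_)
open import Relation.Unary using (Pred)

------------------------------------------------------------------------
-- k-graphs

-- Vertex sets are taken to be the standard finite sets Fin n.

record KGraph (k n : ℕ) : Set where
  field
    edge    : Subset n → Bool
    uniform : ∀ S → T (edge S) → ∣ S ∣ ≡ k

  E : Pred (Subset n) 0ℓ
  E S = T (edge S)

open KGraph public using (E)

subsets : ∀ n → List (Subset n)
subsets zero    = [] ∷ []
subsets (suc n) = map (inside ∷_) (subsets n) ++ map (outside ∷_) (subsets n)

subsetsOfSize : ∀ j n → List (Subset n)
subsetsOfSize j n = filter (λ S → ∣ S ∣ ≟ j) (subsets n)

deg : ∀ {k n} → KGraph k n → Subset n → ℕ
deg {k} {n} H T =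
  length (filter (λ S → T? (KGraph.edge H (S ∪ T))) (subsetsOfSize (k ∸ ∣ T ∣) n))

-- The value 0 on the empty list only matters for δ ℓ H when ℓ exceeds the
-- number of vertices.

minimum : List ℕ → ℕ
minimum []       = 0
minimum (x ∷ xs) = min x xs

δ : ∀ {k n} → ℕ → KGraph k n → ℕ
δ {n = n} ℓ H = minimum (map (deg H) (subsetsOfSize ℓ n))

------------------------------------------------------------------------
-- Families and extremal numbers

Family : ℕ → Set₁
Family k = ∀ m → Pred (KGraph k m) 0ℓ

image : ∀ {m n} → (Fin m → Fin n) → Subset m → Subset n
image f S = tabulate λ j → does (any? λ i → (i ∈? S) ×-dec (f i Fin.≟ j))

Contains : ∀ {k n m} → KGraph k n → KGraph k m → Set
Contains {n = n} {m} H G =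
  Σ (Fin m → Fin n) λ f →
    Injective _≡_ _≡_ f × (∀ S → E G S → E H (image f S))

Free : ∀ {k n} → Family k → KGraph k n → Set
Free F H = ∀ m G → F m G → ¬ Contains H G

IsEx : ∀ {k} → ℕ → Family k → ℕ → ℕ → Set
IsEx {k} ℓ F n v =
    ((Σ (KGraph k n) λ H → Free F H × δ ℓ H ≡ v) × (∀ (H : KGraph k n) → Free F H → δ ℓ H ≤ v))
  ⊎ ((∀ (H : KGraph k n) → ¬ Free F H) × v ≡ 0)

private

  -- The number of j-subsets of an n-set is n C j.

  count-inside : ∀ {n} j (xs : List (Subset n)) →
    length (filter (λ S → ∣ S ∣ ≟ suc j) (map (inside ∷_) xs)) ≡
    length (filter (λ S → ∣ S ∣ ≟ j) xs)
  count-inside j [] = refl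
  count-inside j (S ∷ xs) with ∣ S ∣ ℕ.≡ᵇ j
  ... | true  = cong suc (count-inside j xs)
  ... | false = count-inside j xs

  count-inside-0 : ∀ {n} (xs : List (Subset n)) →
    length (filter (λ S → ∣ S ∣ ≟ 0) (map (inside ∷_) xs)) ≡ 0
  count-inside-0 []       = refl
  count-inside-0 (_ ∷ xs) = count-inside-0 xs

  count-outside : ∀ {n} j (xs : List (Subset n)) →
    length (filter (λ S → ∣ S ∣ ≟ j) (map (outside ∷_) xs)) ≡
    length (filter (λ S → ∣ S ∣ ≟ j) xs)
  count-outside j [] = refl
  count-outside j (S ∷ xs) with ∣ S ∣ ℕ.≡ᵇ j
  ... | true  = cong suc (count-outside j xs)
  ... | false = count-outside j xs

  split : ∀ j n → length (subsetsOfSize j (suc n)) ≡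
    length (filter (λ S → ∣ S ∣ ≟ j) (map (inside ∷_) (subsets n))) ℕ.+
    length (subsetsOfSize j n)
  split j n = begin
    length (filter P (is ++ os))               ≡⟨ cong length (filter-++ P is os) ⟩
    length (filter P is ++ filter P os)        ≡⟨ length-++ (filter P is) ⟩
    length (filter P is) ℕ.+ length (filter P os)
      ≡⟨ cong (length (filter P is) ℕ.+_) (count-outside j (subsets n)) ⟩
    length (filter P is) ℕ.+ length (subsetsOfSize j n) ∎
    where
    open ≡-Reasoning
    P = λ (S : Subset (suc n)) → ∣ S ∣ ≟ j
    is = map (inside ∷_) (subsets n)
    os = map (outside ∷_) (subsets n)

length-subsetsOfSize : ∀ j n → length (subsetsOfSize j n) ≡ n C j
length-subsetsOfSize zero    zero    = refl
length-subsetsOfSize (suc j) zero    = refl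
length-subsetsOfSize zero    (suc n) = trans (split 0 n)
  (trans (cong₂ ℕ._+_ (count-inside-0 (subsets n)) (length-subsetsOfSize 0 n)) refl)
length-subsetsOfSize (suc j) (suc n) = trans (split (suc j) n)
  (trans (cong₂ ℕ._+_ (trans (count-inside j (subsets n)) (length-subsetsOfSize j n))
                      (length-subsetsOfSize (suc j) n))
         (nCk+nC[k+1]≡[n+1]C[k+1] n j))

deg≤ : ∀ {k n} (H : KGraph k n) T → deg H T ≤ n C (k ∸ ∣ T ∣)
deg≤ {k} {n} H T = subst (deg H T ≤_) (length-subsetsOfSize (k ∸ ∣ T ∣) n)
  (length-filter (λ S → T? (KGraph.edge H (S ∪ T))) (subsetsOfSize (k ∸ ∣ T ∣) n))

δ≤ : ∀ {k n} ℓ (H : KGraph k n) → δ ℓ H ≤ n C (k ∸ ℓ)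
δ≤ {k} {n} ℓ H = go (all-filter (λ S → ∣ S ∣ ≟ ℓ) (subsets n))
  where
  go : ∀ {Ts} → All (λ T → ∣ T ∣ ≡ ℓ) Ts → minimum (map (deg H) Ts) ≤ n C (k ∸ ℓ)
  go []                        = z≤n
  go {T ∷ Ts} (∣T∣≡ℓ ∷ _) = ℕ.≤-trans (min≤⊤ (deg H T) (map (deg H) Ts))
    (subst (λ i → deg H T ≤ n C (k ∸ i)) ∣T∣≡ℓ (deg≤ H T))

module _ (em : ExcludedMiddle 0ℓ) where

  ∃-IsEx : ∀ {k} ℓ (F : Family k) n → ∃ (IsEx ℓ F n)
  ∃-IsEx {k} ℓ F n with em {Σ (KGraph k n) (Free F)}
  ... | no ¬∃H = 0 , inj₂ ((λ H free → ¬∃H (H , free)) , refl)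
  ... | yes (H₀ , free₀) = search (n C (k ∸ ℓ)) λ H _ → δ≤ ℓ H
    where
    search : ∀ b → (∀ (H : KGraph k n) → Free F H → δ ℓ H ≤ b) → ∃ (IsEx ℓ F n)
    search b bound with em {∃[ H ] Free {k} {n} F H × δ ℓ H ≡ b}
    search b       bound | yes attained = b , inj₁ (attained , bound)
    search zero    bound | no  ¬attained =
      contradiction (H₀ , free₀ , ℕ.n≤0⇒n≡0 (bound H₀ free₀)) ¬attained
    search (suc b) bound | no  ¬attained = search b λ H free →
      ℕ.≤-pred (ℕ.≤∧≢⇒< (bound H free) λ eq → ¬attained (H , free , eq))

  ex : ∀ {k} → ℕ → Family k → ℕ → ℕ
  ex ℓ F n = proj₁ (∃-IsEx ℓ F n)

  ex≤ : ∀ {k} ℓ (F : Family k) n → ex ℓ F n ≤ n C (k ∸ ℓ)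
  ex≤ ℓ F n with ∃-IsEx ℓ F n
  ... | _ , inj₁ ((H , _ , refl) , _) = δ≤ ℓ H
  ... | _ , inj₂ (_ , refl)           = z≤n

------------------------------------------------------------------------
-- Dedekind reals

-- lower q and upper q mean q < x and x < q respectively.

record ℝ : Set₁ where
  field
    lower upper    : Pred ℚ 0ℓ
    lower-nonempty : ∃ lower
    upper-nonempty : ∃ upper
    lower-closed   : ∀ {q r} → q < r → lower r → lower q
    upper-closed   : ∀ {q r} → q < r → upper q → upper r
    lower-open     : ∀ {q} → lower q → ∃[ r ] q < r × lower r
    upper-open     : ∀ {r} → upper r → ∃[ q ] q < r × upper q
    disjoint       : ∀ {q} → lower q → ¬ upper q
    located        : ∀ {q r} → q < r → lower q ⊎ upper r

open ℝ public using (lower; upper)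

infix 4 _≈_ _⟶_

_≈_ : ℝ → ℝ → Set
x ≈ y = ∀ q → (lower x q ⇔ lower y q) × (upper x q ⇔ upper y q)

_⟶_ : (ℕ → ℚ) → ℝ → Set
a ⟶ L = ∀ ε → 0ℚ < ε → ∃[ N ] ∀ n → N ≤ n →
  lower L (a n ℚ.- ε) × upper L (a n ℚ.+ ε)

private

  pred< : ∀ q → ∃[ r ] r < q
  pred< q = q ℚ.- 1ℚ , subst (q ℚ.- 1ℚ <_) (ℚ.+-identityʳ q)
    (ℚ.+-monoʳ-< q (ℚ.negative⁻¹ (ℚ.- 1ℚ)))

  suc> : ∀ q → ∃[ r ] q < r
  suc> q = q ℚ.+ 1ℚ , subst (_< q ℚ.+ 1ℚ) (ℚ.+-identityʳ q)
    (ℚ.+-monoʳ-< q (ℚ.positive⁻¹ 1ℚ))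

module _ (em : ExcludedMiddle 0ℓ) where

  -- sup { a n : n ∈ ℕ } for a sequence bounded above

  sup : (a : ℕ → ℚ) (M : ℚ) → (∀ n → a n ℚ.≤ M) → ℝ
  sup a M a≤M = record
    { lower          = lo
    ; upper          = up
    ; lower-nonempty = let q , q<a = pred< (a 0) in q , 0 , q<a
    ; upper-nonempty = let q , M<q = suc> M in q , M , M<q , a≤M
    ; lower-closed   = λ { q<r (n , r<a) → n , ℚ.<-trans q<r r<a }
    ; upper-closed   = λ { q<r (s , s<q , a≤s) → s , ℚ.<-trans s<q q<r , a≤s }
    ; lower-open     = λ { (n , q<a) → let r , q<r , r<a = ℚ.<-dense q<a in
                           r , q<r , n , r<a }
    ; upper-open     = λ { (s , s<r , a≤s) → let q , s<q , q<r = ℚ.<-dense s<r in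
                           q , q<r , s , s<q , a≤s }
    ; disjoint       = λ { (n , q<a) (s , s<q , a≤s) →
                           ℚ.<-irrefl refl (ℚ.<-≤-trans (ℚ.<-trans s<q q<a) (a≤s n)) }
    ; located        = loc
    }
    where
    lo up : Pred ℚ 0ℓ
    lo q = ∃[ n ] q < a n
    up q = ∃[ s ] s < q × (∀ n → a n ℚ.≤ s)

    loc : ∀ {q r} → q < r → lo q ⊎ up r
    loc {q} q<r with em {lo q}
    ... | yes l = inj₁ l
    ... | no ¬l = inj₂ (q , q<r , λ n → ℚ.≮⇒≥ λ q<a → ¬l (n , q<a))

  -- inf { x n : n ∈ ℕ } for a sequence of reals bounded below

  inf : (x : ℕ → ℝ) (m : ℚ) → (∀ n → lower (x n) m) → ℝ
  inf x m m<x = record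
    { lower          = lo
    ; upper          = up
    ; lower-nonempty = let q , q<m = pred< m in q , m , q<m , m<x
    ; upper-nonempty = let q , x<q = ℝ.upper-nonempty (x 0) in q , 0 , x<q
    ; lower-closed   = λ { q<r (s , r<s , s<x) → s , ℚ.<-trans q<r r<s , s<x }
    ; upper-closed   = λ { q<r (n , x<q) → n , ℝ.upper-closed (x n) q<r x<q }
    ; lower-open     = λ { (s , q<s , s<x) → let r , q<r , r<s = ℚ.<-dense q<s in
                           r , q<r , s , r<s , s<x }
    ; upper-open     = λ { (n , x<r) → let q , q<r , x<q = ℝ.upper-open (x n) x<r in
                           q , q<r , n , x<q }
    ; disjoint       = λ { (s , q<s , s<x) (n , x<q) →
                           ℝ.disjoint (x n) (ℝ.lower-closed (x n) q<s (s<x n)) x<q }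
    ; located        = loc
    }
    where
    lo up : Pred ℚ 0ℓ
    lo q = ∃[ s ] q < s × (∀ n → lower (x n) s)
    up q = ∃[ n ] upper (x n) q

    loc : ∀ {q r} → q < r → lo q ⊎ up r
    loc {q} {r} q<r with em {up r}
    ... | yes u = inj₂ u
    ... | no ¬u = let s , q<s , s<r = ℚ.<-dense q<r in
      inj₁ (s , q<s , λ n → below n (ℝ.located (x n) s<r))
      where
      below : ∀ {s} n → lower (x n) s ⊎ upper (x n) r → lower (x n) s
      below n (inj₁ l) = l
      below n (inj₂ u) = contradiction (n , u) ¬u

  limsup : (a : ℕ → ℚ) (m M : ℚ) → (∀ n → m < a n) → (∀ n → a n ℚ.≤ M) → ℝ
  limsup a m M m<a a≤M =
    inf (λ N → sup (λ n → a (N ℕ.+ n)) M (λ n → a≤M (N ℕ.+ n))) m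
        (λ N → 0 , m<a (N ℕ.+ 0))

------------------------------------------------------------------------
-- ℓ-degree Turán density

infixl 7 _÷_

_÷_ : ℕ → ℕ → ℚ
m ÷ zero  = 0ℚ
m ÷ suc d = + m / suc d

private

  -1<÷ : ∀ m d → ℚ.- 1ℚ < m ÷ d
  -1<÷ m zero    = ℚ.negative⁻¹ (ℚ.- 1ℚ)
  -1<÷ m (suc d) = ℚ.<-≤-trans (ℚ.negative⁻¹ (ℚ.- 1ℚ))
    (ℚ.nonNegative⁻¹ (+ m / suc d) {{ℚ.normalize-nonNeg m (suc d)}})

  ÷≤1 : ∀ {m d} → m ≤ d → m ÷ d ℚ.≤ 1ℚ
  ÷≤1 {d = zero}    _   = ℚ.nonNegative⁻¹ 1ℚ
  ÷≤1 {m} {suc d} m≤d = ℚ.toℚᵘ-cancel-≤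
    (ℚᵘ.≤-trans (ℚᵘ.≤-reflexive (ℚ.toℚᵘ-fromℚᵘ (ℚᵘ.mkℚᵘ (+ m) d)))
      (ℚᵘ.*≤* (ℤ.≤-trans (ℤ.≤-reflexive (ℤ.*-identityʳ (+ m)))
        (ℤ.≤-trans (ℤ.+≤+ m≤d) (ℤ.≤-reflexive (sym (ℤ.*-identityˡ (+ suc d))))))))

module _ (em : ExcludedMiddle 0ℓ) where

  -- Every ratio lies in [0, 1]; those with n C (k ∸ ℓ) = 0, i.e. n < k ∸ ℓ,
  -- are set to 0.

  density : ∀ {k} → ℕ → Family k → ℕ → ℚ
  density {k} ℓ F n = ex em ℓ F n ÷ (n C (k ∸ ℓ))

  π : ∀ {k} → ℕ → Family k → ℝ
  π {k} ℓ F = limsup em (density ℓ F) (ℚ.- 1ℚ) 1ℚ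
    (λ n → -1<÷ (ex em ℓ F n) (n C (k ∸ ℓ)))
    (λ n → ÷≤1 (ex≤ em ℓ F n))

{-# OPTIONS --safe #-}
module Submission where

-- For H on n vertices and n much larger than m, a random injection φ of m
-- vertices into H pulls H back to an induced subgraph whose ℓ-degrees all have
-- density at least that of H, up to a small error.  It suffices to control one
-- vertex at a time: for every set A of size less than k in the sample, the number
-- of ordered extensions of A ∪ {v} to an edge should have almost the same mean over
-- v in the sample as over all v.  This is a sum of independent bounded variables, so
-- each of the at most (m + 1) ^ k requirements fails with probability exponentially
-- small in m (Chernoff), and φ fails to be injective with probability O(m² / n).
-- Hence density n ≤ density m + ε for all large m and all n large in terms of m,
-- which forces convergence.

open import Defs
open import Axiom.ExcludedMiddle using (ExcludedMiddle)
open import Data.Bool.Base using (Bool; true; false; T)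
open import Data.Bool.Properties using (T?)
open import Data.Fin.Base using (Fin; zero; suc)
import Data.Fin.Properties as Fin
open import Data.Fin.Properties using (any?)
open import Data.Fin.Subset using (Subset; inside; outside; _∪_; ∣_∣; ⁅_⁆; ⊥; _∉_; _⊆_)
  renaming (_∈_ to _∈ˢ_)
open import Data.Fin.Subset.Properties
  using (∣p∣≤∣x∷p∣; ∉⊥; ∣⊥∣≡0; x∈⁅x⁆; x∈⁅y⁆⇒x≡y; ∣⁅x⁆∣≡1; ⊆-antisym; p⊆p∪q; q⊆p∪q; x∈p∪q⁻;
         ∪-identityˡ; ∪-identityʳ; ∪-comm; ∪-assoc)
open import Data.Integer.Base using (+≤+) renaming (+_ to pos)
import Data.Integer.Base as ℤ
import Data.Integer.Properties as ℤ
open import Data.List.Base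
  using (List; []; _∷_; _++_; map; filter; length; allFin; cartesianProductWith)
open import Data.List.Extrema.Nat using (argmin-sel; min≤v⁺)
open import Data.List.Membership.Propositional using (_∈_)
open import Data.List.Membership.Propositional.Properties
  using (∈-allFin; ∈-++⁺ˡ; ∈-++⁺ʳ; ∈-map⁺; ∈-map⁻; ∈-filter⁺; ∈-filter⁻)
open import Data.List.Properties
  using (map-++; map-∘; map-cong; map-tabulate; length-tabulate; length-map)
open import Data.List.Relation.Unary.All using (All; []; _∷_)
import Data.List.Relation.Unary.All as All
import Data.List.Relation.Unary.All.Properties as All
open import Data.List.Relation.Unary.Any using (here; there)
import Data.List.Relation.Unary.Any as Any
open import Data.Nat.Base
open import Data.Nat.Combinatorics using (_C_; nCk≡nPk/k!)
open import Data.Nat.Combinatorics.Base using (_P_; _P′_)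
open import Data.Nat.Combinatorics.Specification using (k!∣nP′k)
open import Data.Nat.DivMod using (m*[n/m]≡n)
open import Data.Nat.ListAction using (sum; product)
open import Data.Nat.ListAction.Properties using (sum-++)
open import Data.Nat.Properties
open import Data.Nat.Tactic.RingSolver using (solve-∀)
open import Data.Product.Base using (∃-syntax; _×_; _,_; proj₁; proj₂)
open import Data.Rational.Base as ℚ using (ℚ; mkℚ; 0ℚ; 1ℚ; ½)
import Data.Rational.Properties as ℚ
import Data.Rational.Unnormalised.Base as ℚᵘ
import Data.Rational.Unnormalised.Properties as ℚᵘ
open import Data.Sum.Base using (inj₁; inj₂)
open import Data.Vec.Base using (Vec; []; _∷_; lookup; here; there)
open import Data.Vec.Properties using (lookup∘tabulate; lookup⇒[]=; []=⇒lookup)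
open import Function.Base using (_∘_; id)
open import Function.Bundles using (mk⇔)
open import Function.Definitions using (Injective)
open import Level using (0ℓ)
open import Relation.Binary.PropositionalEquality
open import Relation.Nullary using (Dec; does; yes; no; contradiction; ¬_)
open import Relation.Unary using (Pred; Decidable)

-- For `ℓ = 0`, averaging over all `m`-subsets shows that densities never increase. A minimum degree
-- is not controlled by averages: one sample must serve all its `ℓ`-sets at once, so the failure
-- probability of one requirement has to beat their number, and the `O(1/m)` of Chebyshev is in
-- general too weak. Sets of every size below `k` occur because the sums over vertices of `H` are
-- replaced one at a time. Chernoff is run without exponentials, within natural numbers: each
-- sampled value contributes a factor `1 + t`, where `t` is its scaled shortfall from the mean.
-- Independence makes the expected product exactly 1; to have it, all maps are sampled and not only
-- injections. When the total shortfall is large, AM-GM applied to bounds for the reciprocals forces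
-- the product to be exponentially large, and Markov's inequality finishes.

private variable
  I I′ : Set
  k m n : ℕ

-- Finite sums

∑ : List I → (I → ℕ) → ℕ
∑ xs f = sum (map f xs)

∑-cong : ∀ (xs : List I) {f g : I → ℕ} → (∀ x → f x ≡ g x) → ∑ xs f ≡ ∑ xs g
∑-cong xs f≗g = cong sum (map-cong f≗g xs)

∑-++ : ∀ (xs ys : List I) (f : I → ℕ) → ∑ (xs ++ ys) f ≡ ∑ xs f + ∑ ys f
∑-++ xs ys f = trans (cong sum (map-++ f xs ys)) (sum-++ (map f xs) (map f ys))

∑-map : ∀ (g : I → I′) (xs : List I) (f : I′ → ℕ) → ∑ (map g xs) f ≡ ∑ xs (f ∘ g)
∑-map g xs f = cong sum (sym (map-∘ xs))

∑-mono-∈ : ∀ (xs : List I) {f g : I → ℕ} → (∀ {x} → x ∈ xs → f x ≤ g x) → ∑ xs f ≤ ∑ xs g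
∑-mono-∈ []       f≤g = z≤n
∑-mono-∈ (x ∷ xs) f≤g = +-mono-≤ (f≤g (here refl)) (∑-mono-∈ xs (f≤g ∘ there))

∑-mono : ∀ (xs : List I) {f g : I → ℕ} → (∀ x → f x ≤ g x) → ∑ xs f ≤ ∑ xs g
∑-mono xs f≤g = ∑-mono-∈ xs λ {x} _ → f≤g x

∑-+ : ∀ (xs : List I) (f g : I → ℕ) → ∑ xs (λ x → f x + g x) ≡ ∑ xs f + ∑ xs g
∑-+ []       f g = refl
∑-+ (x ∷ xs) f g rewrite ∑-+ xs f g = lemma (f x) (g x) (∑ xs f) (∑ xs g)
  where
  lemma : ∀ a b c d → a + b + (c + d) ≡ a + c + (b + d)
  lemma = solve-∀

∑-*ˡ : ∀ (xs : List I) c (f : I → ℕ) → ∑ xs (λ x → c * f x) ≡ c * ∑ xs f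
∑-*ˡ []       c f = sym (*-zeroʳ c)
∑-*ˡ (x ∷ xs) c f rewrite ∑-*ˡ xs c f = sym (*-distribˡ-+ c (f x) (∑ xs f))

∑-*ʳ : ∀ (xs : List I) c (f : I → ℕ) → ∑ xs (λ x → f x * c) ≡ ∑ xs f * c
∑-*ʳ xs c f = trans (∑-cong xs λ x → *-comm (f x) c) (trans (∑-*ˡ xs c f) (*-comm c _))

∑-const : ∀ (xs : List I) c → ∑ xs (λ _ → c) ≡ length xs * c
∑-const []       c = refl
∑-const (x ∷ xs) c = cong (c +_) (∑-const xs c)

∑-zero : ∀ (xs : List I) {f : I → ℕ} → (∀ x → f x ≡ 0) → ∑ xs f ≡ 0
∑-zero xs f≗0 = trans (∑-cong xs f≗0) (trans (∑-const xs 0) (*-zeroʳ (length xs)))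

∑-swap : ∀ (xs : List I) (ys : List I′) (f : I → I′ → ℕ) →
  ∑ xs (λ x → ∑ ys (f x)) ≡ ∑ ys (λ y → ∑ xs (λ x → f x y))
∑-swap []       ys f = sym (∑-zero ys λ _ → refl)
∑-swap (x ∷ xs) ys f rewrite ∑-swap xs ys f = sym (∑-+ ys (f x) _)

term≤∑ : ∀ {xs : List I} {x} → x ∈ xs → (f : I → ℕ) → f x ≤ ∑ xs f
term≤∑ (here refl)        f = m≤m+n _ _
term≤∑ {xs = y ∷ _} (there x∈xs) f = ≤-trans (term≤∑ x∈xs f) (m≤n+m _ (f y))

-- The first moment method: natural numbers with mean below 1 cannot all be positive. It yields the
-- good map in `union-bound`.
∑<length⇒zero : ∀ (xs : List I) (f : I → ℕ) → ∑ xs f < length xs → ∃[ x ] f x ≡ 0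
∑<length⇒zero (x ∷ xs) f lt with f x in fx≡
... | zero  = x , fx≡
... | suc a = ∑<length⇒zero xs f (≤-<-trans (m≤n+m _ a) (≤-pred lt))

∑-suc : ∀ n (f : Fin (suc n) → ℕ) → ∑ (allFin (suc n)) f ≡ f zero + ∑ (allFin n) (f ∘ suc)
∑-suc n f = cong (f zero +_) (trans (cong (λ xs → ∑ xs f) (sym (map-tabulate (λ i → i) suc)))
                                    (∑-map suc (allFin n) f))

-- The sample space: probabilities and expectations appear below as sums over this list, compared
-- with `n ^ m`.
vecs : ∀ n m → List (Vec (Fin n) m)
vecs n zero    = [] ∷ []
vecs n (suc m) = cartesianProductWith _∷_ (allFin n) (vecs n m)

∑-vecs : ∀ n m (f : Vec (Fin n) (suc m) → ℕ) →
  ∑ (vecs n (suc m)) f ≡ ∑ (allFin n) (λ v → ∑ (vecs n m) (λ φ → f (v ∷ φ)))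
∑-vecs n m f = go (allFin n)
  where
  go : ∀ vs → ∑ (cartesianProductWith _∷_ vs (vecs n m)) f ≡ ∑ vs (λ v → ∑ (vecs n m) (λ φ → f (v ∷ φ)))
  go []       = refl
  go (v ∷ vs) = trans (∑-++ (map (v ∷_) (vecs n m)) _ f)
    (cong₂ _+_ (∑-map (v ∷_) (vecs n m) f) (go vs))

length-allFin : ∀ n → length (allFin n) ≡ n
length-allFin n = length-tabulate {n = n} (λ i → i)

∑-const-Fin : ∀ n c → ∑ (allFin n) (λ _ → c) ≡ n * c
∑-const-Fin n c = trans (∑-const (allFin n) c) (cong (_* c) (length-allFin n))

length-vecs : ∀ n m → length (vecs n m) ≡ n ^ m
length-vecs n zero    = refl
length-vecs n (suc m) = begin
  length (vecs n (suc m))                                ≡⟨ *-identityʳ _ ⟨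
  length (vecs n (suc m)) * 1                            ≡⟨ ∑-const (vecs n (suc m)) 1 ⟨
  ∑ (vecs n (suc m)) (λ _ → 1)                           ≡⟨ ∑-vecs n m _ ⟩
  ∑ (allFin n) (λ _ → ∑ (vecs n m) (λ _ → 1))            ≡⟨ ∑-const-Fin n _ ⟩
  n * ∑ (vecs n m) (λ _ → 1)                             ≡⟨ cong (n *_) (trans (∑-const (vecs n m) 1) (*-identityʳ _)) ⟩
  n * length (vecs n m)                                  ≡⟨ cong (n *_) (length-vecs n m) ⟩
  n * n ^ m                                              ∎
  where open ≡-Reasoning

-- The inequality of arithmetic and geometric means

^-distribʳ-* : ∀ k a b → (a * b) ^ k ≡ a ^ k * b ^ k
^-distribʳ-* zero    a b = refl
^-distribʳ-* (suc k) a b rewrite ^-distribʳ-* k a b = [m*n]*[o*p]≡[m*o]*[n*p] a b (a ^ k) (b ^ k)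

2xy≤x²+y² : ∀ x y → 2 * (x * y) ≤ x * x + y * y
2xy≤x²+y² x y with ≤-total x y
... | inj₁ x≤y = subst (λ y → 2 * (x * y) ≤ x * x + y * y) (m+[n∸m]≡n x≤y) (ordered x (y ∸ x))
  where
  expand : ∀ x d → x * x + (x + d) * (x + d) ≡ 2 * (x * (x + d)) + d * d
  expand = solve-∀
  ordered : ∀ x d → 2 * (x * (x + d)) ≤ x * x + (x + d) * (x + d)
  ordered x d = ≤-trans (m≤m+n _ (d * d)) (≤-reflexive (sym (expand x d)))
... | inj₂ y≤x = subst (λ x → 2 * (x * y) ≤ x * x + y * y) (m+[n∸m]≡n y≤x) (ordered y (x ∸ y))
  where
  expand : ∀ y d → (y + d) * (y + d) + y * y ≡ 2 * ((y + d) * y) + d * d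
  expand = solve-∀
  ordered : ∀ y d → 2 * ((y + d) * y) ≤ (y + d) * (y + d) + y * y
  ordered y d = ≤-trans (m≤m+n _ (d * d)) (≤-reflexive (sym (expand y d)))

-- The tangent line of x ↦ x ^ suc r at y lies below the graph.
tangent≤power : ∀ r x y → suc r * (x * y ^ r) ≤ x ^ suc r + r * y ^ suc r
tangent≤power zero x y = ≤-reflexive (linear x)
  where
  linear : ∀ x → 1 * (x * 1) ≡ x * 1 + 0
  linear = solve-∀
tangent≤power (suc r) x y = +-cancelˡ-≤ (suc r * (x * (x * z)) + r * (x * (y * z))) _ _ (begin
  suc r * (x * (x * z)) + r * (x * (y * z)) + suc (suc r) * (x * (y * z))
    ≡⟨ regroupˡ r x y z ⟩
  x * (suc r * (x * z)) + suc r * z * (2 * (x * y))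
    -- The inductive bound times `x`, plus `2xy ≤ x² + y²` times `suc r * y ^ r`; what both sides
    -- share is cancelled.
    ≤⟨ +-mono-≤ (*-monoʳ-≤ x (tangent≤power r x y)) (*-monoʳ-≤ (suc r * z) (2xy≤x²+y² x y)) ⟩
  x * (x ^ suc r + r * (y * z)) + suc r * z * (x * x + y * y)
    ≡⟨ regroupʳ r x y z (x ^ suc r) ⟩
  suc r * (x * (x * z)) + r * (x * (y * z)) + (x * x ^ suc r + suc r * (y * (y * z))) ∎)
  where
  open ≤-Reasoning
  z = y ^ r
  regroupˡ : ∀ r x y z → suc r * (x * (x * z)) + r * (x * (y * z)) + suc (suc r) * (x * (y * z))
                       ≡ x * (suc r * (x * z)) + suc r * z * (2 * (x * y))
  regroupˡ = solve-∀
  regroupʳ : ∀ r x y z p → x * (p + r * (y * z)) + suc r * z * (x * x + y * y)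
    ≡ suc r * (x * (x * z)) + r * (x * (y * z)) + (x * p + suc r * (y * (y * z)))
  regroupʳ = solve-∀

-- Two-point weighted AM-GM: the mean of one copy of a and r copies of s / r.
weighted-amgm : ∀ r a s → suc r ^ suc r * (a * s ^ r) ≤ r ^ r * (a + s) ^ suc r
weighted-amgm zero a s = ≤-trans (≤-reflexive (linear a)) (*-monoʳ-≤ 1 (*-monoˡ-≤ 1 (m≤m+n a s)))
  where
  linear : ∀ a → 1 * 1 * (a * 1) ≡ 1 * (a * 1)
  linear = solve-∀
weighted-amgm r@(suc _) a s = *-cancelʳ-≤ _ _ r (+-cancelʳ-≤ (r * (s * suc r * y ^ r)) _ _ (begin
  suc r ^ suc r * (a * s ^ r) * r + r * (s * suc r * y ^ r)
    ≡⟨ cong (λ p → suc r ^ suc r * (a * s ^ r) * r + r * (s * suc r * p)) (^-distribʳ-* r s (suc r)) ⟩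
  suc r ^ suc r * (a * s ^ r) * r + r * (s * suc r * (s ^ r * suc r ^ r))
    ≡⟨ regroup r a s (suc r ^ r) (s ^ r) ⟩
  suc r * (x * (s ^ r * suc r ^ r))
    ≡⟨ cong (λ p → suc r * (x * p)) (^-distribʳ-* r s (suc r)) ⟨
  suc r * (x * y ^ r)
    ≤⟨ tangent≤power r x y ⟩
  x ^ suc r + r * (y * y ^ r)
    ≡⟨ cong (_+ r * (y * y ^ r)) (trans (^-distribʳ-* (suc r) (a + s) r) (rotate ((a + s) ^ suc r) r (r ^ r))) ⟩
  r ^ r * (a + s) ^ suc r * r + r * (s * suc r * y ^ r) ∎))
  where
  open ≤-Reasoning
  -- The means `(a + s) / (r + 1)` and `s / r`, multiplied by `r (r + 1)` to clear fractions; the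
  -- tangent is taken at the second.
  x = (a + s) * r
  y = s * suc r
  regroup : ∀ r a s p q → suc r * p * (a * q) * r + r * (s * suc r * (q * p))
                        ≡ suc r * ((a + s) * r * (q * p))
  regroup = solve-∀
  rotate : ∀ p r q → p * (r * q) ≡ q * p * r
  rotate = solve-∀

amgm : ∀ xs → length xs ^ length xs * product xs ≤ sum xs ^ length xs
amgm []       = ≤-refl
amgm (a ∷ xs) = *-cancelˡ-≤ (r ^ r) {{r^r≢0 r}} (begin
  r ^ r * (suc r ^ suc r * (a * product xs)) ≡⟨ rotate (r ^ r) (suc r ^ suc r) a (product xs) ⟩
  suc r ^ suc r * a * (r ^ r * product xs)   ≤⟨ *-monoʳ-≤ (suc r ^ suc r * a) (amgm xs) ⟩
  suc r ^ suc r * a * s ^ r                  ≡⟨ *-assoc (suc r ^ suc r) a (s ^ r) ⟩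
  suc r ^ suc r * (a * s ^ r)                ≤⟨ weighted-amgm r a s ⟩
  r ^ r * (a + s) ^ suc r                    ∎)
  where
  open ≤-Reasoning
  r = length xs
  s = sum xs
  r^r≢0 : ∀ r → NonZero (r ^ r)
  r^r≢0 zero    = _
  r^r≢0 (suc r) = m^n≢0 (suc r) (suc r)
  rotate : ∀ p q a c → p * (q * (a * c)) ≡ q * a * (p * c)
  rotate = solve-∀

product≤mean^length : ∀ xs c → sum xs ≤ length xs * c → product xs ≤ c ^ length xs
product≤mean^length []         c _   = ≤-refl
product≤mean^length xs@(_ ∷ _) c s≤rc = *-cancelˡ-≤ (r ^ r) {{m^n≢0 r r}} (begin
  r ^ r * product xs ≤⟨ amgm xs ⟩
  sum xs ^ r         ≤⟨ ^-monoˡ-≤ r s≤rc ⟩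
  (r * c) ^ r        ≡⟨ ^-distribʳ-* r r c ⟩
  r ^ r * c ^ r      ∎)
  where
  open ≤-Reasoning
  r = length xs

-- Induction on d: 1 + 1/3q is at most the square root of 1 + 1/q, and one of the two
-- resulting exponentials absorbs a linear factor.
polynomial≤exponential : ∀ d q → ∃[ c ] ∀ m → m ^ d * q ^ m ≤ c * suc q ^ m
polynomial≤exponential zero    q = 1 , λ m → *-monoʳ-≤ 1 (^-monoˡ-≤ m (n≤1+n q))
polynomial≤exponential (suc d) zero = 1 , λ where
  zero    → z≤n
  (suc m) → ≤-trans (≤-reflexive (*-zeroʳ (suc m ^ suc d))) z≤n
polynomial≤exponential (suc d) q@(suc _) with polynomial≤exponential d (3 * q)
... | c , bound = 3 * q * c , λ m → *-cancelˡ-≤ (p ^ m * p ^ m) {{m*n≢0 (p ^ m) (p ^ m) {{m^n≢0 p m}} {{m^n≢0 p m}}}} (begin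
  p ^ m * p ^ m * (m ^ suc d * q ^ m)               ≡⟨ split (p ^ m) m (m ^ d) (q ^ m) ⟩
  m * p ^ m * (m ^ d * p ^ m) * q ^ m               ≤⟨ *-monoˡ-≤ (q ^ m) (*-mono-≤ (linear m) (bound m)) ⟩
  p * suc p ^ m * (c * suc p ^ m) * q ^ m           ≡⟨ join p (suc p ^ m) c (q ^ m) ⟩
  p * c * (suc p ^ m * suc p ^ m * q ^ m)           ≡⟨ cong (p * c *_) (merge m (suc p) q) ⟩
  p * c * (suc p * suc p * q) ^ m                   ≤⟨ *-monoʳ-≤ (p * c) (^-monoˡ-≤ m (root q)) ⟩
  p * c * (p * p * suc q) ^ m                       ≡⟨ cong (p * c *_) (merge m p (suc q)) ⟨
  p * c * (p ^ m * p ^ m * suc q ^ m)               ≡⟨ swap (p * c) (p ^ m * p ^ m) (suc q ^ m) ⟩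
  p ^ m * p ^ m * (p * c * suc q ^ m)               ∎)
  where
  open ≤-Reasoning
  -- The square of `1 + 1/3q` is `1 + 2/3q + 1/9q²`, below `1 + 1/q`; with `2 * q` it would
  -- overshoot.
  p = 3 * q
  split : ∀ a m b c → a * a * (m * b * c) ≡ m * a * (b * a) * c
  split = solve-∀
  join : ∀ p a c q → p * a * (c * a) * q ≡ p * c * (a * a * q)
  join = solve-∀
  swap : ∀ a b c → a * (b * c) ≡ b * (a * c)
  swap = solve-∀
  merge : ∀ m a b → a ^ m * a ^ m * b ^ m ≡ (a * a * b) ^ m
  merge m a b = sym (trans (^-distribʳ-* m (a * a) b) (cong (_* b ^ m) (^-distribʳ-* m a a)))
  linear : ∀ m → m * p ^ m ≤ p * suc p ^ m
  linear zero    = z≤n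
  linear (suc m) = begin
    p ^ suc m + m * p ^ suc m       ≤⟨ +-mono-≤ (*-monoʳ-≤ p (^-monoˡ-≤ m (n≤1+n p))) (≤-reflexive (swap m p (p ^ m))) ⟩
    p * suc p ^ m + p * (m * p ^ m) ≤⟨ +-monoʳ-≤ (p * suc p ^ m) (*-monoʳ-≤ p (linear m)) ⟩
    p * suc p ^ m + p * (p * suc p ^ m) ≡⟨ *-distribˡ-+ p (suc p ^ m) (p * suc p ^ m) ⟨
    p * suc p ^ suc m ∎
  expand : ∀ q → 3 * suc q * (3 * suc q) * suc (suc q)
               ≡ suc (3 * suc q) * suc (3 * suc q) * suc q + (3 * q * q + 5 * q + 2)
  expand = solve-∀
  root : ∀ q {{_ : NonZero q}} → suc (3 * q) * suc (3 * q) * q ≤ 3 * q * (3 * q) * suc q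
  root (suc q) = ≤-trans (m≤m+n _ (3 * q * q + 5 * q + 2)) (≤-reflexive (sym (expand q)))

-- Random maps and Chernoff weights

𝟙 : Bool → ℕ
𝟙 true  = 1
𝟙 false = 0

𝟙*≤ : ∀ {P : Set} (P? : Dec P) {a b} → (P → a ≤ b) → 𝟙 (does P?) * a ≤ b
𝟙*≤ (yes p) {a} a≤b = ≤-trans (≤-reflexive (+-identityʳ a)) (a≤b p)
𝟙*≤ (no _)  a≤b = z≤n

off : Subset m → List (Fin m)
off []            = []
off (inside  ∷ p) = map suc (off p)
off (outside ∷ p) = zero ∷ map suc (off p)

length-off : (p : Subset m) → length (off p) + ∣ p ∣ ≡ m
length-off []            = refl
length-off (inside  ∷ p) = trans (cong (_+ suc ∣ p ∣) (length-map suc (off p)))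
                             (trans (+-suc _ _) (cong suc (length-off p)))
length-off (outside ∷ p) = cong suc (trans (cong (_+ ∣ p ∣) (length-map suc (off p))) (length-off p))

-- Recursive in the vector, so that `∑-product-off` can peel off one coordinate at a time;
-- `image-lookup` identifies it with `image (lookup φ)`.
img : Subset m → Vec (Fin n) m → Subset n
img []            []      = ⊥
img (inside  ∷ p) (v ∷ φ) = img p φ ∪ ⁅ v ⁆
img (outside ∷ p) (v ∷ φ) = img p φ

-- Given the values of φ on p, its values off p are independent and uniform.
∑-product-off : (p : Subset m) (w : Subset n → Fin n → ℕ) (g : ℕ) →
  (∀ A → ∑ (allFin n) (w A) ≡ n * g) →
  ∑ (vecs n m) (λ φ → product (map (w (img p φ) ∘ lookup φ) (off p))) ≡ n ^ m * g ^ length (off p)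
∑-product-off []                    w g mean = refl
∑-product-off {suc m} {n} (inside ∷ p) w g mean = begin
  ∑ (vecs n (suc m)) (λ φ → product (map (w (img (inside ∷ p) φ) ∘ lookup φ) (map suc (off p))))
    ≡⟨ ∑-vecs n m _ ⟩
  ∑ (allFin n) (λ v → ∑ (vecs n m) (λ φ → product (map (w (img p φ ∪ ⁅ v ⁆) ∘ lookup (v ∷ φ)) (map suc (off p)))))
    ≡⟨ ∑-cong (allFin n) (λ v → ∑-cong (vecs n m) λ φ → cong product (map-∘ (off p))) ⟨
  ∑ (allFin n) (λ v → ∑ (vecs n m) (λ φ → product (map (w (img p φ ∪ ⁅ v ⁆) ∘ lookup φ) (off p))))
    -- Since `v` joins the image, the induction runs with the shifted weight; this is why the mean
    -- is assumed for every `A`.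
    ≡⟨ ∑-cong (allFin n) (λ v → ∑-product-off p (w ∘ (_∪ ⁅ v ⁆)) g (λ A → mean (A ∪ ⁅ v ⁆))) ⟩
  ∑ (allFin n) (λ v → n ^ m * g ^ length (off p))
    ≡⟨ ∑-const-Fin n _ ⟩
  n * (n ^ m * g ^ length (off p))
    ≡⟨ *-assoc n _ _ ⟨
  n ^ suc m * g ^ length (off p)
    ≡⟨ cong (λ l → n ^ suc m * g ^ l) (length-map suc (off p)) ⟨
  n ^ suc m * g ^ length (off (inside ∷ p)) ∎
  where open ≡-Reasoning
∑-product-off {suc m} {n} (outside ∷ p) w g mean = begin
  ∑ (vecs n (suc m)) (λ φ → product (map (w (img (outside ∷ p) φ) ∘ lookup φ) (off (outside ∷ p))))
    ≡⟨ ∑-vecs n m _ ⟩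
  ∑ (allFin n) (λ v → ∑ (vecs n m) (λ φ → w (img p φ) v * product (map (w (img p φ) ∘ lookup (v ∷ φ)) (map suc (off p)))))
    ≡⟨ ∑-cong (allFin n) (λ v → ∑-cong (vecs n m) λ φ → cong (λ xs → w (img p φ) v * product xs) (map-∘ (off p))) ⟨
  ∑ (allFin n) (λ v → ∑ (vecs n m) (λ φ → w (img p φ) v * W φ))
    -- The image of `p` does not depend on `v` here, so after the swap the new factor averages to
    -- `g`.
    ≡⟨ ∑-swap (allFin n) (vecs n m) _ ⟩
  ∑ (vecs n m) (λ φ → ∑ (allFin n) (λ v → w (img p φ) v * W φ))
    ≡⟨ ∑-cong (vecs n m) (λ φ → trans (∑-*ʳ (allFin n) (W φ) _) (cong (_* W φ) (mean (img p φ)))) ⟩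
  ∑ (vecs n m) (λ φ → n * g * W φ)
    ≡⟨ trans (∑-*ˡ (vecs n m) (n * g) W) (cong (n * g *_) (∑-product-off p w g mean)) ⟩
  n * g * (n ^ m * g ^ length (off p))
    ≡⟨ [m*n]*[o*p]≡[m*o]*[n*p] n g (n ^ m) (g ^ length (off p)) ⟩
  n ^ suc m * g ^ suc (length (off p))
    ≡⟨ cong (λ l → n ^ suc m * g ^ suc l) (length-map suc (off p)) ⟨
  n ^ suc m * g ^ length (off (outside ∷ p)) ∎
  where
  open ≡-Reasoning
  W : Vec _ _ → ℕ
  W φ = product (map (w (img p φ) ∘ lookup φ) (off p))

product-map-* : ∀ (f g : I → ℕ) xs → product (map (λ x → f x * g x) xs) ≡ product (map f xs) * product (map g xs)
product-map-* f g []       = refl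
product-map-* f g (x ∷ xs) rewrite product-map-* f g xs = [m*n]*[o*p]≡[m*o]*[n*p] (f x) (g x) _ _

^≤product : ∀ (f : I → ℕ) c xs → All (λ x → c ≤ f x) xs → c ^ length xs ≤ product (map f xs)
^≤product f c []       []           = ≤-refl
^≤product f c (x ∷ xs) (c≤fx ∷ all) = *-mono-≤ c≤fx (^≤product f c xs all)

-- Chernoff weights: w z is 1 + (Y - z) / QG up to the factor QG, and c z bounds
-- its inverse from above, up to the factor Q²G.
module Weights (q G Y : ℕ) (Y≤G : Y ≤ G) where

  Q : ℕ
  Q = 2 + q

  w c : ℕ → ℕ
  w z = (Q * G + Y) ∸ z
  c z = ((Q * Q + 2) * G + Q * z) ∸ Q * Y

  w+z : ∀ {z} → z ≤ G → w z + z ≡ Q * G + Y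
  w+z {z} z≤G = m∸n+n≡m (≤-trans z≤G (≤-trans (m≤m+n G _) (m≤m+n (Q * G) Y)))

  c+QY : ∀ z → c z + Q * Y ≡ (Q * Q + 2) * G + Q * z
  c+QY z = m∸n+n≡m (≤-trans (*-monoʳ-≤ Q Y≤G) (≤-trans (*-monoˡ-≤ G (≤-trans (m≤m*n Q Q) (m≤m+n (Q * Q) 2))) (m≤m+n _ (Q * z))))

  inverse : ∀ {z} → z ≤ G → Q * Q * G * (Q * G) ≤ w z * c z
  inverse {z} z≤G with ≤-total z Y
  ... | inj₁ z≤Y = below (Y ∸ z) (G ∸ (Y ∸ z)) (m+[n∸m]≡n z≤Y)
                     (m+[n∸m]≡n (≤-trans (m∸n≤m Y z) Y≤G))
    where
    below : ∀ d f → z + d ≡ Y → d + f ≡ G → Q * Q * G * (Q * G) ≤ w z * c z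
    below d f eY eG = ≤-trans (≤-trans (m≤m+n _ (excess q d f)) (≤-reflexive (subst (λ g → Q * Q * g * (Q * g) + excess q d f ≡ (Q * g + d) * (Q * (1 + q) * g + Q * f + 2 * g)) eG (expand q d f))))
      (≤-reflexive (cong₂ _*_
        (sym (+-cancelʳ-≡ z (w z) (Q * G + d) (trans (w+z z≤G) (subst (λ y → Q * G + y ≡ Q * G + d + z) eY (left (Q * G) z d)))))
        (sym (+-cancelʳ-≡ (Q * Y) (c z) _ (trans (c+QY z) (subst₂ (λ y g → (Q * Q + 2) * g + Q * z ≡ Q * (1 + q) * g + Q * f + 2 * g + Q * y) eY eG (right q z d f)))))))
      where
      excess : ℕ → ℕ → ℕ → ℕ
      excess q d f = (2 + q) * (d * d + 4 * (d * f) + 2 * (f * f)) + 2 * (d * d) + 2 * (d * f)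
      expand : ∀ q d f → (2 + q) * (2 + q) * (d + f) * ((2 + q) * (d + f)) + ((2 + q) * (d * d + 4 * (d * f) + 2 * (f * f)) + 2 * (d * d) + 2 * (d * f))
        ≡ ((2 + q) * (d + f) + d) * ((2 + q) * (1 + q) * (d + f) + (2 + q) * f + 2 * (d + f))
      expand = solve-∀
      left : ∀ a z d → a + (z + d) ≡ a + d + z
      left = solve-∀
      right : ∀ q z d f → ((2 + q) * (2 + q) + 2) * (d + f) + (2 + q) * z ≡ (2 + q) * (1 + q) * (d + f) + (2 + q) * f + 2 * (d + f) + (2 + q) * (z + d)
      right = solve-∀
  ... | inj₂ Y≤z = above (z ∸ Y) (G ∸ (z ∸ Y)) (m+[n∸m]≡n Y≤z)
                     (m+[n∸m]≡n (≤-trans (m∸n≤m z Y) z≤G))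
    where
    above : ∀ d f → Y + d ≡ z → d + f ≡ G → Q * Q * G * (Q * G) ≤ w z * c z
    above d f ez eG = ≤-trans (≤-trans (m≤m+n _ (excess q d f)) (≤-reflexive (subst (λ g → Q * Q * g * (Q * g) + excess q d f ≡ ((1 + q) * g + f) * ((Q * Q + 2) * g + Q * d)) eG (expand q d f))))
      (≤-reflexive (cong₂ _*_
        (sym (+-cancelʳ-≡ z (w z) ((1 + q) * G + f) (trans (w+z z≤G) (subst₂ (λ x g → Q * g + Y ≡ (1 + q) * g + f + x) ez eG (left q Y d f)))))
        (sym (+-cancelʳ-≡ (Q * Y) (c z) _ (trans (c+QY z) (subst (λ x → (Q * Q + 2) * G + Q * x ≡ (Q * Q + 2) * G + Q * d + Q * Y) ez (right ((Q * Q + 2) * G) Q Y d)))))))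
      where
      excess : ℕ → ℕ → ℕ → ℕ
      excess q d f = q * (d * d) + (4 * q + 6) * (d * f) + (2 * q + 4) * (f * f)
      expand : ∀ q d f → (2 + q) * (2 + q) * (d + f) * ((2 + q) * (d + f)) + (q * (d * d) + (4 * q + 6) * (d * f) + (2 * q + 4) * (f * f))
        ≡ ((1 + q) * (d + f) + f) * (((2 + q) * (2 + q) + 2) * (d + f) + (2 + q) * d)
      expand = solve-∀
      left : ∀ q y d f → (2 + q) * (d + f) + y ≡ (1 + q) * (d + f) + f + (y + d)
      left = solve-∀
      right : ∀ a b y d → a + b * (y + d) ≡ a + b * d + b * y
      right = solve-∀

  module _ {b} (1+b≡Q² : suc b ≡ Q * Q) (zs : List ℕ) (deficit : Q * sum zs + 3 * (length zs * G) ≤ Q * (length zs * Y)) where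

    l : ℕ
    l = length zs

    ∑c : ∀ zs → sum (map c zs) + length zs * (Q * Y) ≡ length zs * ((Q * Q + 2) * G) + Q * sum zs
    ∑c []       = sym (*-zeroʳ Q)
    ∑c (z ∷ zs) = begin
      c z + sum (map c zs) + (Q * Y + r * (Q * Y))   ≡⟨ interchange (c z) _ (Q * Y) _ ⟩
      c z + Q * Y + (sum (map c zs) + r * (Q * Y))   ≡⟨ cong₂ _+_ (c+QY z) (∑c zs) ⟩
      K + Q * z + (r * K + Q * sum zs)               ≡⟨ regroup K (r * K) Q z (sum zs) ⟩
      K + r * K + Q * (z + sum zs)                   ∎
      where
      open ≡-Reasoning
      r = length zs
      K = (Q * Q + 2) * G
      interchange : ∀ a b c d → a + b + (c + d) ≡ a + c + (b + d)
      interchange = solve-∀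
      regroup : ∀ a b q z s → a + q * z + (b + q * s) ≡ a + b + q * (z + s)
      regroup = solve-∀

    -- In units of `Q²G`, the mean of `c` is `1 + 2/Q²` minus the mean of `t`, which `deficit` makes
    -- at least `3/Q²`. So two of the three units pay for the slack in `c`, and the third leaves
    -- `1 - 1/Q² = b/Q²`.
    ∑c≤ : sum (map c zs) ≤ length (map c zs) * (G * b)
    ∑c≤ = +-cancelʳ-≤ (l * (Q * Y) + 3 * (l * G)) _ _ (begin
      sum (map c zs) + (l * (Q * Y) + 3 * (l * G))    ≡⟨ +-assoc (sum (map c zs)) _ _ ⟨
      sum (map c zs) + l * (Q * Y) + 3 * (l * G)      ≡⟨ cong (_+ 3 * (l * G)) (∑c zs) ⟩
      l * ((Q * Q + 2) * G) + Q * sum zs + 3 * (l * G) ≡⟨ +-assoc (l * ((Q * Q + 2) * G)) _ _ ⟩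
      l * ((Q * Q + 2) * G) + (Q * sum zs + 3 * (l * G)) ≤⟨ +-monoʳ-≤ (l * ((Q * Q + 2) * G)) deficit ⟩
      l * ((Q * Q + 2) * G) + Q * (l * Y)             ≡⟨ cong (λ s → l * ((s + 2) * G) + Q * (l * Y)) 1+b≡Q² ⟨
      l * ((suc b + 2) * G) + Q * (l * Y)             ≡⟨ regroup l b G Q Y ⟩
      l * (G * b) + (l * (Q * Y) + 3 * (l * G))       ≡⟨ cong (λ k → k * (G * b) + (l * (Q * Y) + 3 * (l * G))) (length-map c zs) ⟨
      length (map c zs) * (G * b) + (l * (Q * Y) + 3 * (l * G)) ∎)
      where
      open ≤-Reasoning
      regroup : ∀ l b g q y → l * ((suc b + 2) * g) + q * (l * y) ≡ l * (g * b) + (l * (q * y) + 3 * (l * g))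
      regroup = solve-∀

    -- By AM-GM the product of the `c z` is small, and `inverse` turns this into a lower bound for
    -- the product of the `w z`: at least `(Q²/b) ^ l` times `(Q * G) ^ l`, its mean over all maps.
    chernoff : .{{_ : NonZero G}} → All (_≤ G) zs → (Q * Q) ^ l * (Q * G) ^ l ≤ product (map w zs) * b ^ l
    chernoff zs≤G = *-cancelʳ-≤ _ _ (G ^ l) {{m^n≢0 G l}} (begin
      (Q * Q) ^ l * (Q * G) ^ l * G ^ l               ≡⟨ swap ((Q * Q) ^ l) ((Q * G) ^ l) (G ^ l) ⟩
      (Q * Q) ^ l * G ^ l * (Q * G) ^ l               ≡⟨ cong (_* (Q * G) ^ l) (^-distribʳ-* l (Q * Q) G) ⟨
      (Q * Q * G) ^ l * (Q * G) ^ l                   ≡⟨ ^-distribʳ-* l (Q * Q * G) (Q * G) ⟨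
      (Q * Q * G * (Q * G)) ^ l                       ≤⟨ ^≤product (λ z → w z * c z) _ zs (All.map inverse zs≤G) ⟩
      product (map (λ z → w z * c z) zs)              ≡⟨ product-map-* w c zs ⟩
      product (map w zs) * product (map c zs)         ≤⟨ *-monoʳ-≤ (product (map w zs)) (product≤mean^length (map c zs) (G * b) ∑c≤) ⟩
      product (map w zs) * (G * b) ^ length (map c zs) ≡⟨ cong (λ k → product (map w zs) * (G * b) ^ k) (length-map c zs) ⟩
      product (map w zs) * (G * b) ^ l                ≡⟨ cong (product (map w zs) *_) (^-distribʳ-* l G b) ⟩
      product (map w zs) * (G ^ l * b ^ l)            ≡⟨ rotate (product (map w zs)) (G ^ l) (b ^ l) ⟩
      product (map w zs) * b ^ l * G ^ l              ∎)
      where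
      open ≤-Reasoning
      swap : ∀ a b c → a * b * c ≡ a * c * b
      swap = solve-∀
      rotate : ∀ a b c → a * (b * c) ≡ a * c * b
      rotate = solve-∀

-- Deficient samples are exponentially rare

module Deviation {n : ℕ} .{{_ : NonZero n}} (e′ R : ℕ) .{{_ : NonZero R}}
  (x : Subset n → Fin n → ℕ) (x≤R : ∀ A v → x A v ≤ R) where

  private
    e G : ℕ
    e = suc e′
    G = n * R

    Y : Subset n → ℕ
    Y A = ∑ (allFin n) (x A)

    Y≤G : ∀ A → Y A ≤ G
    Y≤G A = ≤-trans (∑-mono (allFin n) (x≤R A)) (≤-reflexive (∑-const-Fin n R))

  -- With A the image of p, the average of x A over the sample points off p falls
  -- short of its average over all vertices by at least R / e.
  Deficient : Subset m → Vec (Fin n) m → Set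
  Deficient p φ =
    e * (n * ∑ (off p) (x (img p φ) ∘ lookup φ)) + length (off p) * (n * R)
      ≤ e * (length (off p) * ∑ (allFin n) (x (img p φ)))

  deficient? : ∀ (p : Subset m) φ → Dec (Deficient p φ)
  deficient? p φ = _ ≤? _

  private
    -- `Q = 3e` turns a shortfall of `G / e` into the `3G / Q` of `deficit`. Values are multiplied
    -- by `n`, so that their mean over all vertices is the integer `Y A`.
    module W A = Weights (1 + 3 * e′) G (Y A) (Y≤G A)

    Q : ℕ
    Q = 3 + 3 * e′

    w : Subset n → Fin n → ℕ
    w A v = W.w A (n * x A v)

    nx≤G : ∀ A v → n * x A v ≤ G
    nx≤G A v = *-monoʳ-≤ n (x≤R A v)

    mean-w : ∀ A → ∑ (allFin n) (w A) ≡ n * (Q * G)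
    mean-w A = +-cancelʳ-≡ (n * Y A) _ _ (begin
      ∑ (allFin n) (w A) + n * Y A                            ≡⟨ cong (∑ (allFin n) (w A) +_) (∑-*ˡ (allFin n) n (x A)) ⟨
      ∑ (allFin n) (w A) + ∑ (allFin n) (λ v → n * x A v)     ≡⟨ ∑-+ (allFin n) (w A) _ ⟨
      ∑ (allFin n) (λ v → w A v + n * x A v)                  ≡⟨ ∑-cong (allFin n) (λ v → W.w+z A (nx≤G A v)) ⟩
      ∑ (allFin n) (λ _ → Q * G + Y A)                        ≡⟨ ∑-const-Fin n _ ⟩
      n * (Q * G + Y A)                                       ≡⟨ *-distribˡ-+ n (Q * G) (Y A) ⟩
      n * (Q * G) + n * Y A                                   ∎)
      where open ≡-Reasoning

  module _ {b} (1+b≡Q² : suc b ≡ Q * Q) where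

    private
      markov : ∀ (p : Subset m) φ → let l = length (off p) in
        𝟙 (does (deficient? p φ)) * (suc b ^ l * (Q * G) ^ l) ≤ product (map (w (img p φ) ∘ lookup φ) (off p)) * b ^ l
      markov p φ = 𝟙*≤ (deficient? p φ) λ deficient → begin
        suc b ^ l * (Q * G) ^ l                  ≡⟨ cong (λ s → s ^ l * (Q * G) ^ l) 1+b≡Q² ⟩
        (Q * Q) ^ l * (Q * G) ^ l                ≡⟨ cong (λ l → (Q * Q) ^ l * (Q * G) ^ l) len ⟨
        (Q * Q) ^ length zs * (Q * G) ^ length zs
          ≤⟨ W.chernoff A 1+b≡Q² zs (scale deficient) {{m*n≢0 n R}} (All.map⁺ (All.universal (λ s → nx≤G A (lookup φ s)) (off p))) ⟩
        product (map (W.w A) zs) * b ^ length zs ≡⟨ cong₂ (λ ys l → product ys * b ^ l) (sym (map-∘ (off p))) len ⟩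
        product (map (w A ∘ lookup φ) (off p)) * b ^ l ∎
        where
        open ≤-Reasoning
        A = img p φ
        l = length (off p)
        zs = map (λ s → n * x A (lookup φ s)) (off p)
        len : length zs ≡ l
        len = length-map _ (off p)
        triple₁ : ∀ e′ s k → (3 + 3 * e′) * s + 3 * k ≡ 3 * (suc e′ * s + k)
        triple₁ = solve-∀
        triple₂ : ∀ e′ k → 3 * (suc e′ * k) ≡ (3 + 3 * e′) * k
        triple₂ = solve-∀
        scale : Deficient p φ → Q * sum zs + 3 * (length zs * G) ≤ Q * (length zs * Y A)
        scale deficient = begin
          Q * sum zs + 3 * (length zs * G)           ≡⟨ triple₁ e′ (sum zs) (length zs * G) ⟩
          3 * (e * sum zs + length zs * G)           ≡⟨ cong₂ (λ s l → 3 * (e * s + l * G)) (∑-*ˡ (off p) n (x A ∘ lookup φ)) len ⟩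
          3 * (e * (n * ∑ (off p) (x A ∘ lookup φ)) + l * G) ≤⟨ *-monoʳ-≤ 3 deficient ⟩
          3 * (e * (l * Y A))                        ≡⟨ triple₂ e′ (l * Y A) ⟩
          Q * (l * Y A)                              ≡⟨ cong (λ l → Q * (l * Y A)) len ⟨
          Q * (length zs * Y A)                      ∎

    -- Markov's inequality: the product of weights has mean `(Q * G) ^ l`, and on deficient maps it
    -- is larger by a factor of at least `(suc b / b) ^ l`.
    ∑-deficient : ∀ (p : Subset m) → let l = length (off p) in
      ∑ (vecs n m) (λ φ → 𝟙 (does (deficient? p φ))) * suc b ^ l ≤ n ^ m * b ^ l
    ∑-deficient {m} p = *-cancelʳ-≤ _ _ ((Q * G) ^ l) {{m^n≢0 (Q * G) l {{m*n≢0 Q G {{_}} {{m*n≢0 n R}}}}}} (begin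
      ∑ (vecs n m) bad * suc b ^ l * (Q * G) ^ l             ≡⟨ *-assoc (∑ (vecs n m) bad) _ _ ⟩
      ∑ (vecs n m) bad * (suc b ^ l * (Q * G) ^ l)           ≡⟨ ∑-*ʳ (vecs n m) _ bad ⟨
      ∑ (vecs n m) (λ φ → bad φ * (suc b ^ l * (Q * G) ^ l)) ≤⟨ ∑-mono (vecs n m) (markov p) ⟩
      ∑ (vecs n m) (λ φ → product (map (w (img p φ) ∘ lookup φ) (off p)) * b ^ l)
        ≡⟨ trans (∑-*ʳ (vecs n m) (b ^ l) _) (cong (_* b ^ l) (∑-product-off p w (Q * G) mean-w)) ⟩
      n ^ m * (Q * G) ^ l * b ^ l                            ≡⟨ swap (n ^ m) ((Q * G) ^ l) (b ^ l) ⟩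
      n ^ m * b ^ l * (Q * G) ^ l                            ∎)
      where
      open ≤-Reasoning
      l = length (off p)
      bad : Vec (Fin n) m → ℕ
      bad φ = 𝟙 (does (deficient? p φ))
      swap : ∀ a b c → a * b * c ≡ a * c * b
      swap = solve-∀

-- The union bound

𝟙*a≡0⇒a≡0 : ∀ {P : Set} (P? : Dec P) {a} → 𝟙 (does P?) * a ≡ 0 → P → a ≡ 0
𝟙*a≡0⇒a≡0 (yes _) {a} eq _ = trans (sym (+-identityʳ a)) eq
𝟙*a≡0⇒a≡0 (no ¬p) _ p = contradiction p ¬p

∑-𝟙≟ : ∀ {n} (u : Fin n) → ∑ (allFin n) (λ v → 𝟙 (does (v Fin.≟ u))) ≡ 1
∑-𝟙≟ {suc n} zero    = trans (∑-suc n (λ v → 𝟙 (does (v Fin.≟ zero)))) (cong suc (∑-zero (allFin n) λ _ → refl))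
∑-𝟙≟ {suc n} (suc u) = trans (∑-suc n (λ v → 𝟙 (does (v Fin.≟ suc u)))) (∑-𝟙≟ u)

repeats : Vec (Fin n) m → ℕ
repeats         []      = 0
repeats {m = suc m} (v ∷ φ) = ∑ (allFin m) (λ s → 𝟙 (does (v Fin.≟ lookup φ s))) + repeats φ

repeats≡0⇒injective : (φ : Vec (Fin n) m) → repeats φ ≡ 0 → Injective _≡_ _≡_ (lookup φ)
repeats≡0⇒injective {m = suc m} (v ∷ φ) eq = inj
  where
  fresh : ∀ s → v ≡ lookup φ s → 0 ≡ 1
  fresh s v≡φs = trans (sym (n≤0⇒n≡0 (subst (𝟙 (does (v Fin.≟ lookup φ s)) ≤_) (m+n≡0⇒m≡0 _ eq)
    (term≤∑ (∈-allFin s) (λ s → 𝟙 (does (v Fin.≟ lookup φ s))))))) (hit (v Fin.≟ lookup φ s))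
    where
    hit : (d : Dec (v ≡ lookup φ s)) → 𝟙 (does d) ≡ 1
    hit (yes _)  = refl
    hit (no neq) = contradiction v≡φs neq
  inj : Injective _≡_ _≡_ (lookup (v ∷ φ))
  inj {zero}  {zero}  _  = refl
  inj {zero}  {suc t} eq = contradiction (fresh t eq) λ ()
  inj {suc s} {zero}  eq = contradiction (fresh s (sym eq)) λ ()
  inj {suc s} {suc t} eq′ = cong suc (repeats≡0⇒injective φ (m+n≡0⇒n≡0 _ eq) eq′)

-- Each of at most `m * m` pairs of positions collides on a fraction `1 / n` of all maps.
∑-repeats : ∀ n m → n * ∑ (vecs n m) repeats ≤ m * m * n ^ m
∑-repeats n zero    = ≤-reflexive (*-zeroʳ n)
∑-repeats n (suc m) = begin
  n * ∑ (vecs n (suc m)) repeats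
    ≡⟨ cong (n *_) (∑-vecs n m repeats) ⟩
  n * ∑ (allFin n) (λ v → ∑ (vecs n m) (λ φ → hits v φ + repeats φ))
    ≡⟨ cong (n *_) (trans (∑-cong (allFin n) (λ v → ∑-+ (vecs n m) (hits v) repeats)) (∑-+ (allFin n) _ _)) ⟩
  n * (∑ (allFin n) (λ v → ∑ (vecs n m) (hits v)) + ∑ (allFin n) (λ _ → ∑ (vecs n m) repeats))
    ≡⟨ cong₂ (λ a b → n * (a + b)) ∑hits (∑-const-Fin n _) ⟩
  n * (n ^ m * m + n * ∑ (vecs n m) repeats)
    ≤⟨ *-monoʳ-≤ n (+-monoʳ-≤ (n ^ m * m) (∑-repeats n m)) ⟩
  n * (n ^ m * m + m * m * n ^ m)
    ≤⟨ m≤m+n _ (suc m * n ^ suc m) ⟩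
  n * (n ^ m * m + m * m * n ^ m) + suc m * (n * n ^ m)
    ≡⟨ expand n m (n ^ m) ⟩
  suc m * suc m * n ^ suc m ∎
  where
  open ≤-Reasoning
  hits : Fin n → Vec (Fin n) m → ℕ
  hits v φ = ∑ (allFin m) (λ s → 𝟙 (does (v Fin.≟ lookup φ s)))
  ∑hits : ∑ (allFin n) (λ v → ∑ (vecs n m) (hits v)) ≡ n ^ m * m
  ∑hits = trans (∑-swap (allFin n) (vecs n m) hits) (trans
    (∑-cong (vecs n m) λ φ → trans (∑-swap (allFin n) (allFin m) _)
      (trans (∑-cong (allFin m) λ s → ∑-𝟙≟ (lookup φ s)) (trans (∑-const-Fin m 1) (*-identityʳ m))))
    (trans (∑-const (vecs n m) m) (cong (_* m) (length-vecs n m))))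
  expand : ∀ n m a → n * (a * m + m * m * a) + suc m * (n * a) ≡ suc m * suc m * (n * a)
  expand = solve-∀

∑-subsets : ∀ n (f : Subset (suc n) → ℕ) →
  ∑ (subsets (suc n)) f ≡ ∑ (subsets n) (f ∘ (inside ∷_)) + ∑ (subsets n) (f ∘ (outside ∷_))
∑-subsets n f = trans (∑-++ (map (inside ∷_) (subsets n)) _ f)
  (cong₂ _+_ (∑-map _ (subsets n) f) (∑-map _ (subsets n) f))

∈-subsets : (p : Subset n) → p ∈ subsets n
∈-subsets []            = here refl
∈-subsets (inside  ∷ p) = ∈-++⁺ˡ (∈-map⁺ _ (∈-subsets p))
∈-subsets (outside ∷ p) = ∈-++⁺ʳ _ (∈-map⁺ _ (∈-subsets p))

-- Pascal's recursion: the halves with and without the first position add up to `(m + 1) ^ k + (m +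
-- 1) ^ (k + 1) = (m + 2)(m + 1) ^ k`.
∑-small-subsets : ∀ k m → ∑ (subsets m) (λ p → 𝟙 (does (∣ p ∣ <? k))) ≤ suc m ^ k
∑-small-subsets zero    m       = ≤-trans (≤-reflexive (∑-zero (subsets m) λ _ → refl)) z≤n
∑-small-subsets (suc k) zero    = m^n>0 1 (suc k)
∑-small-subsets (suc k) (suc m) = begin
  ∑ (subsets (suc m)) (λ p → 𝟙 (does (∣ p ∣ <? suc k)))
    ≡⟨ ∑-subsets m _ ⟩
  ∑ (subsets m) (λ p → 𝟙 (does (∣ p ∣ <? k))) + ∑ (subsets m) (λ p → 𝟙 (does (∣ p ∣ <? suc k)))
    ≤⟨ +-mono-≤ (∑-small-subsets k m) (∑-small-subsets (suc k) m) ⟩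
  suc (suc m) * suc m ^ k
    ≤⟨ *-monoʳ-≤ (suc (suc m)) (^-monoˡ-≤ k (n≤1+n (suc m))) ⟩
  suc (suc m) ^ suc k ∎
  where open ≤-Reasoning

-- The two factors 2 keep the means of `repeats` and of the total failure count `Φ` each below one
-- half, so `Ψ` has mean below 1 and vanishes somewhere.
union-bound : ∀ k b μ (bad : Subset m → Vec (Fin n) m → ℕ) →
  2 * (suc m ^ k * b ^ μ) < suc b ^ μ → 2 * (m * m) < n →
  (∀ p → ∣ p ∣ < k → ∑ (vecs n m) (bad p) * suc b ^ μ ≤ n ^ m * b ^ μ) →
  ∃[ φ ] Injective _≡_ _≡_ (lookup φ) × (∀ p → ∣ p ∣ < k → bad p φ ≡ 0)
union-bound {m} {n} k b μ bad large-m large-n rare =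
  let φ , Ψφ≡0 = ∑<length⇒zero (vecs n m) Ψ (subst (∑ (vecs n m) Ψ <_) (sym (length-vecs n m)) ∑Ψ<)
  in φ , repeats≡0⇒injective φ (m+n≡0⇒m≡0 _ Ψφ≡0) , λ p ∣p∣<k → 𝟙*a≡0⇒a≡0 (∣ p ∣ <? k)
       (n≤0⇒n≡0 (subst (𝟙 (does (∣ p ∣ <? k)) * bad p φ ≤_) (m+n≡0⇒n≡0 (repeats φ) Ψφ≡0)
         (term≤∑ (∈-subsets p) _))) ∣p∣<k
  where
  open ≤-Reasoning
  Φ Ψ : Vec (Fin n) m → ℕ
  Φ φ = ∑ (subsets m) (λ p → 𝟙 (does (∣ p ∣ <? k)) * bad p φ)
  Ψ φ = repeats φ + Φ φ

  instance
    n≢0 : NonZero n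
    n≢0 = >-nonZero (≤-<-trans z≤n large-n)

  few-repeats : 2 * ∑ (vecs n m) repeats < n ^ m
  few-repeats = *-cancelˡ-< n _ _ (begin-strict
    n * (2 * ∑ (vecs n m) repeats) ≡⟨ swap n 2 _ ⟩
    2 * (n * ∑ (vecs n m) repeats) ≤⟨ *-monoʳ-≤ 2 (∑-repeats n m) ⟩
    2 * (m * m * n ^ m)            ≡⟨ *-assoc 2 (m * m) (n ^ m) ⟨
    2 * (m * m) * n ^ m            <⟨ *-monoˡ-< (n ^ m) {{m^n≢0 n m}} large-n ⟩
    n * n ^ m                      ∎)
    where
    swap : ∀ a b c → a * (b * c) ≡ b * (a * c)
    swap = solve-∀

  ∑Φ : ∑ (vecs n m) Φ * suc b ^ μ ≤ suc m ^ k * (n ^ m * b ^ μ)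
  ∑Φ = begin
    ∑ (vecs n m) Φ * suc b ^ μ
      ≡⟨ cong (_* suc b ^ μ) (trans (∑-swap (vecs n m) (subsets m) _) (∑-cong (subsets m) λ p → ∑-*ˡ (vecs n m) (𝟙 (does (∣ p ∣ <? k))) (bad p))) ⟩
    ∑ (subsets m) (λ p → 𝟙 (does (∣ p ∣ <? k)) * ∑ (vecs n m) (bad p)) * suc b ^ μ
      ≡⟨ ∑-*ʳ (subsets m) (suc b ^ μ) _ ⟨
    ∑ (subsets m) (λ p → 𝟙 (does (∣ p ∣ <? k)) * ∑ (vecs n m) (bad p) * suc b ^ μ)
      ≤⟨ ∑-mono (subsets m) (λ p → each p (∣ p ∣ <? k)) ⟩
    ∑ (subsets m) (λ p → 𝟙 (does (∣ p ∣ <? k)) * (n ^ m * b ^ μ))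
      ≡⟨ ∑-*ʳ (subsets m) (n ^ m * b ^ μ) _ ⟩
    ∑ (subsets m) (λ p → 𝟙 (does (∣ p ∣ <? k))) * (n ^ m * b ^ μ)
      ≤⟨ *-monoˡ-≤ (n ^ m * b ^ μ) (∑-small-subsets k m) ⟩
    suc m ^ k * (n ^ m * b ^ μ) ∎
    where
    each : ∀ p (d : Dec (∣ p ∣ < k)) → 𝟙 (does d) * ∑ (vecs n m) (bad p) * suc b ^ μ ≤ 𝟙 (does d) * (n ^ m * b ^ μ)
    each p (no _)      = z≤n
    each p (yes ∣p∣<k) = begin
      1 * ∑ (vecs n m) (bad p) * suc b ^ μ ≡⟨ cong (_* suc b ^ μ) (*-identityˡ (∑ (vecs n m) (bad p))) ⟩
      ∑ (vecs n m) (bad p) * suc b ^ μ     ≤⟨ rare p ∣p∣<k ⟩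
      n ^ m * b ^ μ                        ≡⟨ *-identityˡ _ ⟨
      1 * (n ^ m * b ^ μ)                  ∎

  few-bad : 2 * ∑ (vecs n m) Φ < n ^ m
  few-bad = *-cancelʳ-< _ _ _ (begin-strict
    2 * ∑ (vecs n m) Φ * suc b ^ μ      ≡⟨ *-assoc 2 (∑ (vecs n m) Φ) (suc b ^ μ) ⟩
    2 * (∑ (vecs n m) Φ * suc b ^ μ)    ≤⟨ *-monoʳ-≤ 2 ∑Φ ⟩
    2 * (suc m ^ k * (n ^ m * b ^ μ))   ≡⟨ pull (suc m ^ k) (n ^ m) (b ^ μ) ⟩
    n ^ m * (2 * (suc m ^ k * b ^ μ))   <⟨ *-monoʳ-< (n ^ m) {{m^n≢0 n m}} large-m ⟩
    n ^ m * suc b ^ μ                   ∎)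
    where
    pull : ∀ a b c → 2 * (a * (b * c)) ≡ b * (2 * (a * c))
    pull = solve-∀

  ∑Ψ< : ∑ (vecs n m) Ψ < n ^ m
  ∑Ψ< = *-cancelˡ-< 2 _ _ (begin-strict
    2 * ∑ (vecs n m) Ψ                                ≡⟨ cong (2 *_) (∑-+ (vecs n m) repeats Φ) ⟩
    2 * (∑ (vecs n m) repeats + ∑ (vecs n m) Φ)       ≡⟨ *-distribˡ-+ 2 (∑ (vecs n m) repeats) _ ⟩
    2 * ∑ (vecs n m) repeats + 2 * ∑ (vecs n m) Φ     <⟨ +-mono-< few-repeats few-bad ⟩
    n ^ m + n ^ m                                     ≡⟨ cong (n ^ m +_) (+-identityʳ (n ^ m)) ⟨
    2 * n ^ m                                         ∎)

eventually-rare : ∀ k b → ∃[ m₀ ] ∀ m → m₀ ≤ m → 2 * (suc m ^ k * b ^ (m ∸ k)) < suc b ^ (m ∸ k)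
eventually-rare k b with polynomial≤exponential (suc k) b
... | c , bound = k + suc (K * c) , λ m m₀≤m →
    rare m (m ∸ k) (m+[n∸m]≡n (≤-trans (m≤m+n k _) m₀≤m))
      (+-cancelˡ-≤ k _ _ (≤-trans m₀≤m (≤-reflexive (sym (m+[n∸m]≡n (≤-trans (m≤m+n k _) m₀≤m))))))
  where
  -- For `μ ≥ 1`, `1 + m = 1 + k + μ ≤ (2 + k) μ`. Degree `suc k` above leaves a spare factor `μ`,
  -- which beats `K * c`.
  K = 2 * (2 + k) ^ k
  rare : ∀ m μ → k + μ ≡ m → K * c < μ → 2 * (suc m ^ k * b ^ μ) < suc b ^ μ
  rare m μ@(suc ν) refl Kc<μ = *-cancelˡ-< μ _ _ (begin-strict
    μ * (2 * (suc m ^ k * b ^ μ))                 ≤⟨ *-monoʳ-≤ μ (*-monoʳ-≤ 2 (*-monoˡ-≤ (b ^ μ) (^-monoˡ-≤ k 1+m≤))) ⟩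
    μ * (2 * (((2 + k) * μ) ^ k * b ^ μ))         ≡⟨ cong (λ p → μ * (2 * (p * b ^ μ))) (^-distribʳ-* k (2 + k) μ) ⟩
    μ * (2 * ((2 + k) ^ k * μ ^ k * b ^ μ))       ≡⟨ pull μ ((2 + k) ^ k) (μ ^ k) (b ^ μ) ⟩
    K * (μ ^ suc k * b ^ μ)                       ≤⟨ *-monoʳ-≤ K (bound μ) ⟩
    K * (c * suc b ^ μ)                           ≡⟨ *-assoc K c _ ⟨
    K * c * suc b ^ μ                             <⟨ *-monoˡ-< (suc b ^ μ) {{m^n≢0 (suc b) μ}} Kc<μ ⟩
    μ * suc b ^ μ                                 ∎)
    where
    open ≤-Reasoning
    pull : ∀ m a p q → m * (2 * (a * p * q)) ≡ 2 * a * (m * p * q)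
    pull = solve-∀
    expand : ∀ k ν → (2 + k) * suc ν ≡ suc (k + suc ν) + (ν + k * ν)
    expand = solve-∀
    1+m≤ : suc (k + μ) ≤ (2 + k) * μ
    1+m≤ = ≤-trans (m≤m+n _ (ν + k * ν)) (≤-reflexive (sym (expand k ν)))

-- Sizes of unions

∣p∪⁅x⁆∣ : ∀ {x} {p : Subset n} → x ∉ p → ∣ p ∪ ⁅ x ⁆ ∣ ≡ suc ∣ p ∣
∣p∪⁅x⁆∣ {x = zero}  {inside  ∷ p} x∉p = contradiction here x∉p
∣p∪⁅x⁆∣ {x = zero}  {outside ∷ p} x∉p = cong (suc ∘ ∣_∣) (∪-identityʳ p)
∣p∪⁅x⁆∣ {x = suc x} {inside  ∷ p} x∉p = cong suc (∣p∪⁅x⁆∣ (x∉p ∘ there))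
∣p∪⁅x⁆∣ {x = suc x} {outside ∷ p} x∉p = ∣p∪⁅x⁆∣ (x∉p ∘ there)

∣p∪q∣≤∣p∣+∣q∣ : ∀ (p q : Subset n) → ∣ p ∪ q ∣ ≤ ∣ p ∣ + ∣ q ∣
∣p∪q∣≤∣p∣+∣q∣ []            []            = z≤n
∣p∪q∣≤∣p∣+∣q∣ (inside  ∷ p) (y       ∷ q) = s≤s (≤-trans (∣p∪q∣≤∣p∣+∣q∣ p q) (+-monoʳ-≤ ∣ p ∣ (∣p∣≤∣x∷p∣ y q)))
∣p∪q∣≤∣p∣+∣q∣ (outside ∷ p) (inside  ∷ q) = ≤-trans (s≤s (∣p∪q∣≤∣p∣+∣q∣ p q)) (≤-reflexive (sym (+-suc ∣ p ∣ ∣ q ∣)))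
∣p∪q∣≤∣p∣+∣q∣ (outside ∷ p) (outside ∷ q) = ∣p∪q∣≤∣p∣+∣q∣ p q

-- Images of sets of positions

∈-image⁺ : ∀ (f : Fin m → Fin n) {S i} → i ∈ˢ S → f i ∈ˢ image f S
∈-image⁺ f {S} {i} i∈S = lookup⇒[]= (f i) _ (trans (lookup∘tabulate _ (f i)) (holds (any? _) (i , i∈S , refl)))
  where
  holds : ∀ {P : Set} (P? : Dec P) → P → does P? ≡ true
  holds (yes _) _ = refl
  holds (no ¬p) p = contradiction p ¬p

∈-image⁻ : ∀ (f : Fin m → Fin n) {S j} → j ∈ˢ image f S → ∃[ i ] i ∈ˢ S × f i ≡ j
∈-image⁻ f {S} {j} j∈ = witness (any? _) (trans (sym (lookup∘tabulate _ j)) ([]=⇒lookup j∈))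
  where
  witness : ∀ {P : Set} (P? : Dec P) → does P? ≡ true → P
  witness (yes p) _ = p

image-∘ : ∀ {l} (g : Fin m → Fin n) (f : Fin l → Fin m) S → image (g ∘ f) S ≡ image g (image f S)
image-∘ g f S = ⊆-antisym to from
  where
  to : image (g ∘ f) S ⊆ image g (image f S)
  to j∈ with ∈-image⁻ (g ∘ f) j∈
  ... | i , i∈S , refl = ∈-image⁺ g (∈-image⁺ f i∈S)
  from : image g (image f S) ⊆ image (g ∘ f) S
  from j∈ with ∈-image⁻ g j∈
  ... | _ , i∈ , refl with ∈-image⁻ f i∈
  ... | i , i∈S , refl = ∈-image⁺ (g ∘ f) i∈S

∈-img⁺ : ∀ {p s} (φ : Vec (Fin n) m) → s ∈ˢ p → lookup φ s ∈ˢ img p φ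
∈-img⁺ {p = inside  ∷ p} {zero}  (v ∷ φ) _           = q⊆p∪q (img p φ) ⁅ v ⁆ (x∈⁅x⁆ v)
∈-img⁺ {p = inside  ∷ p} {suc s} (v ∷ φ) (there s∈p) = p⊆p∪q ⁅ v ⁆ (∈-img⁺ φ s∈p)
∈-img⁺ {p = outside ∷ p} {suc s} (v ∷ φ) (there s∈p) = ∈-img⁺ φ s∈p

∈-img⁻ : ∀ {p u} (φ : Vec (Fin n) m) → u ∈ˢ img p φ → ∃[ s ] s ∈ˢ p × lookup φ s ≡ u
∈-img⁻ {p = []}          []      u∈ = contradiction u∈ ∉⊥
∈-img⁻ {p = inside ∷ p}  (v ∷ φ) u∈ with x∈p∪q⁻ (img p φ) ⁅ v ⁆ u∈
... | inj₁ u∈img = let s , s∈p , eq = ∈-img⁻ φ u∈img in suc s , there s∈p , eq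
... | inj₂ u∈⁅v⁆ = zero , here , sym (x∈⁅y⁆⇒x≡y v u∈⁅v⁆)
∈-img⁻ {p = outside ∷ p} (v ∷ φ) u∈ = let s , s∈p , eq = ∈-img⁻ φ u∈ in suc s , there s∈p , eq

image-lookup : ∀ (φ : Vec (Fin n) m) p → image (lookup φ) p ≡ img p φ
image-lookup φ p = ⊆-antisym to from
  where
  to : image (lookup φ) p ⊆ img p φ
  to u∈ with ∈-image⁻ (lookup φ) u∈
  ... | s , s∈p , refl = ∈-img⁺ φ s∈p
  from : img p φ ⊆ image (lookup φ) p
  from u∈ with ∈-img⁻ φ u∈
  ... | s , s∈p , refl = ∈-image⁺ (lookup φ) s∈p

img-∪⁅⁆ : ∀ (φ : Vec (Fin n) m) p s → img (p ∪ ⁅ s ⁆) φ ≡ img p φ ∪ ⁅ lookup φ s ⁆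
img-∪⁅⁆ φ p s = ⊆-antisym to from
  where
  to : img (p ∪ ⁅ s ⁆) φ ⊆ img p φ ∪ ⁅ lookup φ s ⁆
  to u∈ with ∈-img⁻ {p = p ∪ ⁅ s ⁆} φ u∈
  ... | t , t∈ , refl with x∈p∪q⁻ p ⁅ s ⁆ t∈
  ... | inj₁ t∈p = p⊆p∪q ⁅ lookup φ s ⁆ (∈-img⁺ φ t∈p)
  ... | inj₂ t∈s rewrite x∈⁅y⁆⇒x≡y s t∈s = q⊆p∪q (img p φ) ⁅ lookup φ s ⁆ (x∈⁅x⁆ (lookup φ s))
  from : img p φ ∪ ⁅ lookup φ s ⁆ ⊆ img (p ∪ ⁅ s ⁆) φ
  from {u} u∈ with x∈p∪q⁻ (img p φ) ⁅ lookup φ s ⁆ u∈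
  ... | inj₂ u∈s rewrite x∈⁅y⁆⇒x≡y (lookup φ s) u∈s = ∈-img⁺ φ (q⊆p∪q p ⁅ s ⁆ (x∈⁅x⁆ s))
  ... | inj₁ u∈p with ∈-img⁻ {p = p} φ u∈p
  ... | t , t∈p , refl = ∈-img⁺ φ (p⊆p∪q ⁅ s ⁆ t∈p)

∣img∣ : ∀ (φ : Vec (Fin n) m) → Injective _≡_ _≡_ (lookup φ) → ∀ p → ∣ img p φ ∣ ≡ ∣ p ∣
∣img∣ {n} []  _   []            = ∣⊥∣≡0 n
∣img∣ (v ∷ φ) inj (inside  ∷ p) = trans (∣p∪⁅x⁆∣ fresh) (cong suc (∣img∣ φ (Fin.suc-injective ∘ inj) p))
  where
  fresh : v ∉ img p φ
  fresh v∈ with ∈-img⁻ {p = p} φ v∈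
  ... | s , _ , φs≡v with inj {suc s} {zero} φs≡v
  ... | ()
∣img∣ (v ∷ φ) inj (outside ∷ p) = ∣img∣ φ (Fin.suc-injective ∘ inj) p

∈-off⇒∉ : ∀ (p : Subset m) {s} → s ∈ off p → s ∉ p
∈-off⇒∉ (inside ∷ p) s∈ s∈p with ∈-map⁻ suc s∈
∈-off⇒∉ (inside ∷ p) s∈ (there t∈p) | t , t∈ , refl = ∈-off⇒∉ p t∈ t∈p
∈-off⇒∉ (outside ∷ p) (here refl) ()
∈-off⇒∉ (outside ∷ p) (there s∈) s∈p with ∈-map⁻ suc s∈
∈-off⇒∉ (outside ∷ p) (there s∈) (there t∈p) | t , t∈ , refl = ∈-off⇒∉ p t∈ t∈p

∑-off≤ : ∀ (p : Subset m) (f : Fin m → ℕ) → ∑ (off p) f ≤ ∑ (allFin m) f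
∑-off≤ []                    f = z≤n
∑-off≤ {suc m} (inside  ∷ p) f = ≤-trans (≤-reflexive (∑-map suc (off p) f)) (≤-trans (∑-off≤ p (f ∘ suc))
  (≤-trans (m≤n+m _ (f zero)) (≤-reflexive (sym (∑-suc m f)))))
∑-off≤ {suc m} (outside ∷ p) f = ≤-trans (+-monoʳ-≤ (f zero) (≤-trans (≤-reflexive (∑-map suc (off p) f)) (∑-off≤ p (f ∘ suc))))
  (≤-reflexive (sym (∑-suc m f)))

-- Sampled subgraphs and ordered extensions

pullback : KGraph k n → (φ : Vec (Fin n) m) → Injective _≡_ _≡_ (lookup φ) → KGraph k m
pullback H φ inj = record
  { edge    = λ S → KGraph.edge H (image (lookup φ) S)
  ; uniform = λ S e → trans (sym (∣img∣ φ inj S)) (trans (cong ∣_∣ (sym (image-lookup φ S))) (KGraph.uniform H _ e))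
  }

-- A copy inside the sample, composed with `φ`, is a copy in `H`.
pullback-free : ∀ {F : Family k} {H : KGraph k n} (φ : Vec (Fin n) m) (inj : Injective _≡_ _≡_ (lookup φ)) →
  Free F H → Free F (pullback H φ inj)
pullback-free {H = H} φ inj free l G G∈F (f , f-inj , f-edge) = free l G G∈F
  (lookup φ ∘ f , f-inj ∘ inj , λ S e → subst (E H) (sym (image-∘ (lookup φ) f S)) (f-edge S e))

-- If ∣ A ∣ + j ≡ k then sequences that repeat a vertex or meet A do not contribute,
-- since edges have size k.
ext : KGraph k n → ℕ → Subset n → ℕ
ext         H zero    A = 𝟙 (KGraph.edge H A)
ext {n = n} H (suc j) A = ∑ (allFin n) (λ v → ext H j (A ∪ ⁅ v ⁆))

ext≤ : ∀ (H : KGraph k n) j A → ext H j A ≤ n ^ j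
ext≤ H zero    A with KGraph.edge H A
... | true  = ≤-refl
... | false = z≤n
ext≤ {n = n} H (suc j) A = ≤-trans (∑-mono (allFin n) λ v → ext≤ H j (A ∪ ⁅ v ⁆))
  (≤-reflexive (∑-const-Fin n (n ^ j)))

module Transfer {k m n : ℕ} .{{_ : NonZero n}} (e′ : ℕ) (H : KGraph k n) where

  private
    e : ℕ
    e = suc e′

    module D j = Deviation {n} e′ (n ^ j) {{m^n≢0 n j}} (λ A v → ext H j (A ∪ ⁅ v ⁆)) (λ A v → ext≤ H j (A ∪ ⁅ v ⁆))

  -- Once `p` and one more vertex are chosen, `k ∸ suc ∣ p ∣` vertices of an edge remain.
  Typical : Vec (Fin n) m → Set
  Typical φ = ∀ p → ∣ p ∣ < k → ¬ D.Deficient (k ∸ suc ∣ p ∣) p φ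

  ∃-typical : ∀ {b} → suc b ≡ (3 + 3 * e′) * (3 + 3 * e′) →
    2 * (suc m ^ k * b ^ (m ∸ k)) < suc b ^ (m ∸ k) → 2 * (m * m) < n →
    ∃[ φ ] Injective _≡_ _≡_ (lookup φ) × Typical φ
  ∃-typical {b} 1+b≡Q² large-m large-n =
    let φ , inj , none = union-bound k b (m ∸ k) bad large-m large-n rare
    in φ , inj , λ p ∣p∣<k deficient → contradiction (none p ∣p∣<k) (hit (D.deficient? (k ∸ suc ∣ p ∣) p φ) deficient)
    where
    bad : Subset m → Vec (Fin n) m → ℕ
    bad p φ = 𝟙 (does (D.deficient? (k ∸ suc ∣ p ∣) p φ))

    hit : ∀ {P : Set} (P? : Dec P) → P → 𝟙 (does P?) ≢ 0
    hit (yes _) _ ()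
    hit (no ¬p) p _ = ¬p p

    b≢0 : NonZero b
    b≢0 = ≢-nonZero λ { refl → contradiction (trans 1+b≡Q² (expand e′)) λ () }
      where
      expand : ∀ e → (3 + 3 * e) * (3 + 3 * e) ≡ suc (suc (7 + 18 * e + 9 * (e * e)))
      expand = solve-∀

    -- `(b / suc b) ^ μ` decreases in `μ`, so sets `p` with different numbers of free positions can
    -- share the exponent `m ∸ k`.
    lower-exponent : ∀ μ d x N → x * suc b ^ (μ + d) ≤ N * b ^ (μ + d) → x * suc b ^ μ ≤ N * b ^ μ
    lower-exponent μ d x N le = *-cancelʳ-≤ _ _ (b ^ d) {{m^n≢0 b d {{b≢0}}}} (begin
      x * suc b ^ μ * b ^ d      ≤⟨ *-monoʳ-≤ (x * suc b ^ μ) (^-monoˡ-≤ d (n≤1+n b)) ⟩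
      x * suc b ^ μ * suc b ^ d  ≡⟨ trans (*-assoc x _ _) (cong (x *_) (sym (^-distribˡ-+-* (suc b) μ d))) ⟩
      x * suc b ^ (μ + d)        ≤⟨ le ⟩
      N * b ^ (μ + d)            ≡⟨ trans (cong (N *_) (^-distribˡ-+-* b μ d)) (sym (*-assoc N _ _)) ⟩
      N * b ^ μ * b ^ d          ∎)
      where open ≤-Reasoning

    rare : ∀ p → ∣ p ∣ < k → ∑ (vecs n m) (bad p) * suc b ^ (m ∸ k) ≤ n ^ m * b ^ (m ∸ k)
    rare p ∣p∣<k = lower-exponent (m ∸ k) (length (off p) ∸ (m ∸ k)) (∑ (vecs n m) (bad p)) (n ^ m)
      (subst (λ l → ∑ (vecs n m) (bad p) * suc b ^ l ≤ n ^ m * b ^ l) (sym (m+[n∸m]≡n m∸k≤l))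
        (D.∑-deficient (k ∸ suc ∣ p ∣) 1+b≡Q² p))
      where
      m∸k≤l : m ∸ k ≤ length (off p)
      m∸k≤l = ≤-trans (∸-monoʳ-≤ m (<⇒≤ ∣p∣<k))
        (≤-reflexive (trans (cong (_∸ ∣ p ∣) (sym (length-off p))) (m+n∸n≡m (length (off p)) ∣ p ∣)))

  module _ (k*e≤m : k * e ≤ m) (φ : Vec (Fin n) m) (inj : Injective _≡_ _≡_ (lookup φ)) (typical : Typical φ) where

    private
      H′ : KGraph k m
      H′ = pullback H φ inj

    -- Induction replaces one sum over vertices of `H` by a sum over sampled vertices, at a cost of
    -- `2 / e` each time; so the density of ordered extensions falls by at most `2j / e` in the
    -- sample.
    transfer : ∀ j p → ∣ p ∣ + j ≡ k →
      e * (m ^ j * ext H j (img p φ)) ≤ e * (n ^ j * ext H′ j p) + 2 * j * (m ^ j * n ^ j)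
    transfer zero    p _  = ≤-trans (≤-reflexive (cong (λ A → e * (1 * 𝟙 (KGraph.edge H A))) (sym (image-lookup φ p)))) (m≤m+n _ 0)
    transfer (suc j) p eq = begin
      e * (m ^ suc j * ext H (suc j) A)          ≡⟨ pullˡ e m M (ext H (suc j) A) ⟩
      M * (e * (m * ext H (suc j) A))            ≤⟨ *-monoʳ-≤ M step ⟩
      M * (e * (n * ∑ (off p) x) + 2 * (m * (n * N))) ≡⟨ distribute M e n (∑ (off p) x) m N ⟩
      n * (e * M * ∑ (off p) x) + 2 * (m * M * (n * N)) ≤⟨ +-monoˡ-≤ _ (*-monoʳ-≤ n sumStep) ⟩
      n * (e * (N * ext H′ (suc j) p) + m * (2 * j * (M * N))) + 2 * (m * M * (n * N))
        ≡⟨ collect n e N (ext H′ (suc j) p) m j M ⟩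
      e * (n ^ suc j * ext H′ (suc j) p) + 2 * suc j * (m ^ suc j * n ^ suc j) ∎
      where
      open ≤-Reasoning
      A = img p φ
      M = m ^ j
      N = n ^ j
      l = length (off p)
      x : Fin m → ℕ
      x s = ext H j (A ∪ ⁅ lookup φ s ⁆)

      ∣p∣+1+j : suc (∣ p ∣ + j) ≡ k
      ∣p∣+1+j = trans (sym (+-suc ∣ p ∣ j)) eq

      k∸ : k ∸ suc ∣ p ∣ ≡ j
      k∸ = trans (cong (_∸ suc ∣ p ∣) (sym ∣p∣+1+j)) (m+n∸m≡n ∣ p ∣ j)

      ∣p∣<k : ∣ p ∣ < k
      ∣p∣<k = ≤-trans (s≤s (m≤m+n ∣ p ∣ j)) (≤-reflexive ∣p∣+1+j)

      average : e * (l * ext H (suc j) A) ≤ e * (n * ∑ (off p) x) + l * (n * N)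
      average = <⇒≤ (≰⇒> (subst (λ j → ¬ D.Deficient j p φ) k∸ (typical p ∣p∣<k)))

      step : e * (m * ext H (suc j) A) ≤ e * (n * ∑ (off p) x) + 2 * (m * (n * N))
      step = begin
        e * (m * ext H (suc j) A)
          ≡⟨ cong (λ m → e * (m * ext H (suc j) A)) (length-off p) ⟨
        e * ((l + ∣ p ∣) * ext H (suc j) A)
          ≡⟨ split e l ∣ p ∣ (ext H (suc j) A) ⟩
        e * (l * ext H (suc j) A) + ∣ p ∣ * e * ext H (suc j) A
          -- Two errors of relative size `1 / e`: one from non-deficiency, one from the positions in
          -- `p`, where `∣ p ∣ ≤ k ≤ m / e`.
          ≤⟨ +-mono-≤ average (*-mono-≤ (≤-trans (*-monoˡ-≤ e (<⇒≤ ∣p∣<k)) k*e≤m) (ext≤ H (suc j) A)) ⟩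
        e * (n * ∑ (off p) x) + l * (n * N) + m * (n * N)
          ≤⟨ +-monoˡ-≤ _ (+-monoʳ-≤ (e * (n * ∑ (off p) x)) (*-monoˡ-≤ (n * N) l≤m)) ⟩
        e * (n * ∑ (off p) x) + m * (n * N) + m * (n * N)
          ≡⟨ double (e * (n * ∑ (off p) x)) (m * (n * N)) ⟩
        e * (n * ∑ (off p) x) + 2 * (m * (n * N)) ∎
        where
        l≤m : l ≤ m
        l≤m = ≤-trans (m≤m+n l ∣ p ∣) (≤-reflexive (length-off p))
        split : ∀ e l q y → e * ((l + q) * y) ≡ e * (l * y) + q * e * y
        split = solve-∀
        double : ∀ a b → a + b + b ≡ a + 2 * b
        double = solve-∀

      sumStep : e * M * ∑ (off p) x ≤ e * (N * ext H′ (suc j) p) + m * (2 * j * (M * N))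
      sumStep = begin
        e * M * ∑ (off p) x
          ≡⟨ ∑-*ˡ (off p) (e * M) x ⟨
        ∑ (off p) (λ s → e * M * x s)
          ≤⟨ ∑-mono-∈ (off p) (λ {s} s∈ → each s (∈-off⇒∉ p s∈)) ⟩
        ∑ (off p) (λ s → e * N * ext H′ j (p ∪ ⁅ s ⁆) + 2 * j * (M * N))
          ≤⟨ ∑-off≤ p _ ⟩
        ∑ (allFin m) (λ s → e * N * ext H′ j (p ∪ ⁅ s ⁆) + 2 * j * (M * N))
          ≡⟨ trans (∑-+ (allFin m) _ _) (cong₂ _+_ (∑-*ˡ (allFin m) (e * N) _) (∑-const-Fin m _)) ⟩
        e * N * ext H′ (suc j) p + m * (2 * j * (M * N))
          ≡⟨ cong (_+ m * (2 * j * (M * N))) (*-assoc e N _) ⟩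
        e * (N * ext H′ (suc j) p) + m * (2 * j * (M * N)) ∎
        where
        each : ∀ s → s ∉ p → e * M * x s ≤ e * N * ext H′ j (p ∪ ⁅ s ⁆) + 2 * j * (M * N)
        each s s∉p = begin
          e * M * x s                                  ≡⟨ *-assoc e M (x s) ⟩
          e * (M * x s)                                ≡⟨ cong (λ B → e * (M * ext H j B)) (img-∪⁅⁆ φ p s) ⟨
          e * (M * ext H j (img (p ∪ ⁅ s ⁆) φ))        ≤⟨ transfer j (p ∪ ⁅ s ⁆) (trans (cong (_+ j) (∣p∪⁅x⁆∣ s∉p)) ∣p∣+1+j) ⟩
          e * (N * ext H′ j (p ∪ ⁅ s ⁆)) + 2 * j * (M * N) ≡⟨ cong (_+ 2 * j * (M * N)) (*-assoc e N _) ⟨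
          e * N * ext H′ j (p ∪ ⁅ s ⁆) + 2 * j * (M * N) ∎

      pullˡ : ∀ e m M y → e * (m * M * y) ≡ M * (e * (m * y))
      pullˡ = solve-∀
      distribute : ∀ M e n s m N → M * (e * (n * s) + 2 * (m * (n * N))) ≡ n * (e * M * s) + 2 * (m * M * (n * N))
      distribute = solve-∀
      collect : ∀ n e N y m j M → n * (e * (N * y) + m * (2 * j * (M * N))) + 2 * (m * M * (n * N))
        ≡ e * (n * N * y) + 2 * suc j * (m * M * (n * N))
      collect = solve-∀

-- Degrees as counts of extensions

∑-filter : ∀ {P : Pred I 0ℓ} (P? : Decidable P) (xs : List I) (f : I → ℕ) →
  ∑ (filter P? xs) f ≡ ∑ xs (λ x → 𝟙 (does (P? x)) * f x)
∑-filter P? []       f = refl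
∑-filter P? (x ∷ xs) f with does (P? x)
... | true  = cong₂ _+_ (sym (+-identityʳ (f x))) (∑-filter P? xs f)
... | false = ∑-filter P? xs f

∑-size : ℕ → (Subset n → ℕ) → ℕ
∑-size {n} j f = ∑ (subsets n) (λ S → 𝟙 (does (∣ S ∣ ≟ j)) * f S)

∑-size-suc : ∀ j (f : Subset (suc n) → ℕ) →
  ∑-size (suc j) f ≡ ∑-size j (f ∘ (inside ∷_)) + ∑-size (suc j) (f ∘ (outside ∷_))
∑-size-suc {n} j f = ∑-subsets n (λ S → 𝟙 (does (∣ S ∣ ≟ suc j)) * f S)

∑-size-0 : ∀ (f : Subset n → ℕ) → ∑-size 0 f ≡ f ⊥
∑-size-0 {zero}  f = trans (+-identityʳ _) (+-identityʳ _)
∑-size-0 {suc n} f = trans (∑-subsets n (λ S → 𝟙 (does (∣ S ∣ ≟ 0)) * f S))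
  (trans (cong (_+ ∑-size 0 (f ∘ (outside ∷_))) (∑-zero (subsets n) λ _ → refl)) (∑-size-0 (f ∘ (outside ∷_))))

∑-size-cong : ∀ j {f g : Subset n → ℕ} → (∀ S → f S ≡ g S) → ∑-size j f ≡ ∑-size j g
∑-size-cong {n} j f≗g = ∑-cong (subsets n) λ S → cong (𝟙 (does (∣ S ∣ ≟ j)) *_) (f≗g S)

-- Pairs (v , S) with v ∉ S and ∣ S ∣ ≡ j are counted by their union, of size suc j;
-- f kills the pairs with v ∈ S.
∑-extend : ∀ (f : Subset n → ℕ) j → (∀ U → ∣ U ∣ ≤ j → f U ≡ 0) →
  ∑ (allFin n) (λ v → ∑-size j (λ S → f (S ∪ ⁅ v ⁆))) ≡ suc j * ∑-size (suc j) f
∑-extend {zero}  f j small = sym (*-zeroʳ (suc j))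
∑-extend {suc n} f j small = begin
  ∑ (allFin (suc n)) (λ v → ∑-size j (λ S → f (S ∪ ⁅ v ⁆)))
    ≡⟨ ∑-suc n (λ v → ∑-size j (λ S → f (S ∪ ⁅ v ⁆))) ⟩
  ∑-size j (λ S → f (S ∪ ⁅ zero ⁆)) + ∑ (allFin n) (λ v → ∑-size j (λ S → f (S ∪ ⁅ suc v ⁆)))
    ≡⟨ cong₂ _+_ at-zero (at-suc j small) ⟩
  ∑-size j (f ∘ (inside ∷_)) + (j * ∑-size j (f ∘ (inside ∷_)) + suc j * ∑-size (suc j) (f ∘ (outside ∷_)))
    ≡⟨ collect (∑-size j (f ∘ (inside ∷_))) (∑-size (suc j) (f ∘ (outside ∷_))) j ⟩
  suc j * (∑-size j (f ∘ (inside ∷_)) + ∑-size (suc j) (f ∘ (outside ∷_)))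
    ≡⟨ cong (suc j *_) (∑-size-suc j f) ⟨
  suc j * ∑-size (suc j) f ∎
  where
  open ≡-Reasoning
  collect : ∀ a b j → a + (j * a + suc j * b) ≡ suc j * (a + b)
  collect = solve-∀

  𝟙*-zero : ∀ {P : Set} (P? : Dec P) {a} → (P → a ≡ 0) → 𝟙 (does P?) * a ≡ 0
  𝟙*-zero (yes p) a≡0 = trans (+-identityʳ _) (a≡0 p)
  𝟙*-zero (no _)  _   = refl

  at-zero : ∑-size j (λ S → f (S ∪ ⁅ zero ⁆)) ≡ ∑-size j (f ∘ (inside ∷_))
  at-zero = trans (∑-subsets n (λ S → 𝟙 (does (∣ S ∣ ≟ j)) * f (S ∪ ⁅ zero ⁆))) (cong₂ _+_
    -- A set that already contains `zero` keeps its size `j` in the union, and `f` kills it.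
    (∑-zero (subsets n) λ S → 𝟙*-zero (suc ∣ S ∣ ≟ j) λ eq →
      small _ (≤-reflexive (trans (cong (suc ∘ ∣_∣) (∪-identityʳ S)) eq)))
    (∑-size-cong j λ S → cong (f ∘ (inside ∷_)) (∪-identityʳ S)))

  at-suc : ∀ j → (∀ U → ∣ U ∣ ≤ j → f U ≡ 0) →
    ∑ (allFin n) (λ v → ∑-size j (λ S → f (S ∪ ⁅ suc v ⁆))) ≡
    j * ∑-size j (f ∘ (inside ∷_)) + suc j * ∑-size (suc j) (f ∘ (outside ∷_))
  at-suc zero    small = trans
    (∑-cong (allFin n) λ v → trans (∑-subsets n (λ S → 𝟙 (does (∣ S ∣ ≟ 0)) * f (S ∪ ⁅ suc v ⁆)))
      (cong (_+ ∑-size 0 (λ S → f (outside ∷ (S ∪ ⁅ v ⁆)))) (∑-zero (subsets n) λ _ → refl)))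
    (∑-extend (f ∘ (outside ∷_)) 0 λ U → small (outside ∷ U))
  at-suc (suc j) small = trans
    (trans (∑-cong (allFin n) λ v → ∑-size-suc j (λ S → f (S ∪ ⁅ suc v ⁆)))
           (∑-+ (allFin n) (λ v → ∑-size j (λ S → f (inside ∷ (S ∪ ⁅ v ⁆)))) _))
    (cong₂ _+_ (∑-extend (f ∘ (inside ∷_)) j λ U le → small (inside ∷ U) (s≤s le))
               (∑-extend (f ∘ (outside ∷_)) (suc j) λ U → small (outside ∷ U)))

-- A `j`-set can be added in `j !` orders, one factor `suc j` per use of `∑-extend`. The hypothesis
-- is `≤` because the recursion may add a vertex already in `A`, which leaves the size unchanged.
ext≡∑-size : ∀ (H : KGraph k n) j A → ∣ A ∣ + j ≤ k →
  ext H j A ≡ j ! * ∑-size j (λ S → 𝟙 (KGraph.edge H (S ∪ A)))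
ext≡∑-size H zero    A _  = sym (trans (+-identityʳ _) (trans (∑-size-0 (λ S → 𝟙 (KGraph.edge H (S ∪ A))))
  (cong (𝟙 ∘ KGraph.edge H) (∪-identityˡ A))))
ext≡∑-size {k} {n} H (suc j) A le = begin
  ∑ (allFin n) (λ v → ext H j (A ∪ ⁅ v ⁆))
    ≡⟨ ∑-cong (allFin n) (λ v → ext≡∑-size H j (A ∪ ⁅ v ⁆) (le′ v)) ⟩
  ∑ (allFin n) (λ v → j ! * ∑-size j (λ S → 𝟙 (KGraph.edge H (S ∪ (A ∪ ⁅ v ⁆)))))
    ≡⟨ ∑-*ˡ (allFin n) (j !) (λ v → ∑-size j (λ S → 𝟙 (KGraph.edge H (S ∪ (A ∪ ⁅ v ⁆))))) ⟩
  j ! * ∑ (allFin n) (λ v → ∑-size j (λ S → 𝟙 (KGraph.edge H (S ∪ (A ∪ ⁅ v ⁆)))))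
    ≡⟨ cong (j ! *_) (∑-cong (allFin n) λ v → ∑-size-cong j λ S → cong (𝟙 ∘ KGraph.edge H) (shift S ⁅ v ⁆)) ⟩
  j ! * ∑ (allFin n) (λ v → ∑-size j (λ S → f (S ∪ ⁅ v ⁆)))
    ≡⟨ cong (j ! *_) (∑-extend f j small) ⟩
  j ! * (suc j * ∑-size (suc j) f)
    ≡⟨ rotate (j !) (suc j) _ ⟩
  suc j ! * ∑-size (suc j) f ∎
  where
  open ≡-Reasoning
  f : Subset n → ℕ
  f U = 𝟙 (KGraph.edge H (U ∪ A))

  rotate : ∀ a b c → a * (b * c) ≡ b * a * c
  rotate = solve-∀

  shift : ∀ S V → S ∪ (A ∪ V) ≡ (S ∪ V) ∪ A
  shift S V = trans (cong (S ∪_) (∪-comm A V)) (sym (∪-assoc S V A))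

  le″ : suc (∣ A ∣ + j) ≤ k
  le″ = subst (_≤ k) (+-suc ∣ A ∣ j) le

  le′ : ∀ v → ∣ A ∪ ⁅ v ⁆ ∣ + j ≤ k
  le′ v = ≤-trans (+-monoˡ-≤ j (≤-trans (∣p∪q∣≤∣p∣+∣q∣ A ⁅ v ⁆)
    (≤-reflexive (trans (cong (∣ A ∣ +_) (∣⁅x⁆∣≡1 v)) (+-comm ∣ A ∣ 1))))) le″

  small : ∀ U → ∣ U ∣ ≤ j → f U ≡ 0
  small U ∣U∣≤j with KGraph.edge H (U ∪ A) in eq
  ... | false = refl
  ... | true  = contradiction (≤-reflexive (sym (KGraph.uniform H (U ∪ A) (subst T (sym eq) _))))
    (<⇒≱ (≤-trans (s≤s (≤-trans (∣p∪q∣≤∣p∣+∣q∣ U A) (≤-trans (+-monoˡ-≤ ∣ A ∣ ∣U∣≤j) (≤-reflexive (+-comm j ∣ A ∣))))) le″))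

deg≡∑-size : ∀ (H : KGraph k n) A → deg H A ≡ ∑-size (k ∸ ∣ A ∣) (λ S → 𝟙 (KGraph.edge H (S ∪ A)))
deg≡∑-size {k} {n} H A = begin
  length (filter edge? Ss)                  ≡⟨ *-identityʳ _ ⟨
  length (filter edge? Ss) * 1              ≡⟨ ∑-const (filter edge? Ss) 1 ⟨
  ∑ (filter edge? Ss) (λ _ → 1)             ≡⟨ ∑-filter edge? Ss (λ _ → 1) ⟩
  ∑ Ss (λ S → 𝟙 (KGraph.edge H (S ∪ A)) * 1) ≡⟨ ∑-cong Ss (λ S → *-identityʳ _) ⟩
  ∑ Ss (λ S → 𝟙 (KGraph.edge H (S ∪ A)))    ≡⟨ ∑-filter (λ S → ∣ S ∣ ≟ k ∸ ∣ A ∣) (subsets n) _ ⟩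
  ∑-size (k ∸ ∣ A ∣) (λ S → 𝟙 (KGraph.edge H (S ∪ A))) ∎
  where
  open ≡-Reasoning
  Ss = subsetsOfSize (k ∸ ∣ A ∣) n
  edge? : Decidable (λ S → T (KGraph.edge H (S ∪ A)))
  edge? S = T? (KGraph.edge H (S ∪ A))

ext≡deg : ∀ (H : KGraph k n) j A → ∣ A ∣ + j ≡ k → ext H j A ≡ j ! * deg H A
ext≡deg {k} H j A eq = trans (ext≡∑-size H j A (≤-reflexive eq)) (cong (j ! *_) (sym
  (trans (deg≡∑-size H A) (cong (λ i → ∑-size i (λ S → 𝟙 (KGraph.edge H (S ∪ A)))) k∸∣A∣≡j))))
  where
  k∸∣A∣≡j : k ∸ ∣ A ∣ ≡ j
  k∸∣A∣≡j = trans (cong (_∸ ∣ A ∣) (sym eq)) (m+n∸m≡n ∣ A ∣ j)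

-- Minimum degrees under sampling

minimum≤ : ∀ {x xs} → x ∈ xs → minimum xs ≤ x
minimum≤ {xs = y ∷ xs} (here refl) = min≤v⁺ y xs (inj₁ ≤-refl)
minimum≤ {xs = y ∷ xs} (there x∈)  = min≤v⁺ y xs (inj₂ (Any.map (≤-reflexive ∘ sym) x∈))

minimum∈ : ∀ {x xs} → x ∈ xs → minimum xs ∈ xs
minimum∈ {xs = y ∷ xs} _ with argmin-sel id y xs
... | inj₁ eq = here eq
... | inj₂ ∈  = there ∈

δ≤deg : ∀ {ℓ} (H : KGraph k n) A → ∣ A ∣ ≡ ℓ → δ ℓ H ≤ deg H A
δ≤deg {ℓ = ℓ} H A ∣A∣≡ℓ = minimum≤ (∈-map⁺ (deg H) (∈-filter⁺ (λ S → ∣ S ∣ ≟ ℓ) (∈-subsets A) ∣A∣≡ℓ))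

∃-subset : ∀ {ℓ n} → ℓ ≤ n → ∃[ A ] ∣_∣ {n} A ≡ ℓ
∃-subset {n = n} z≤n = ⊥ , ∣⊥∣≡0 n
∃-subset (s≤s ℓ≤n) = let A , eq = ∃-subset ℓ≤n in inside ∷ A , cong suc eq

-- `ℓ ≤ n` keeps the list of `ℓ`-sets nonempty, away from the default value of `minimum []`.
δ-attained : ∀ {ℓ} (H : KGraph k n) → ℓ ≤ n → ∃[ A ] ∣ A ∣ ≡ ℓ × δ ℓ H ≡ deg H A
δ-attained {ℓ = ℓ} H ℓ≤n with ∃-subset ℓ≤n
... | A , ∣A∣≡ℓ with ∈-map⁻ (deg H) (minimum∈ (∈-map⁺ (deg H) (∈-filter⁺ (λ S → ∣ S ∣ ≟ ℓ) (∈-subsets A) ∣A∣≡ℓ)))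
... | B , B∈ , eq = B , proj₂ (∈-filter⁻ (λ S → ∣ S ∣ ≟ ℓ) {xs = subsets _} B∈) , eq

-- Only the set `p` attaining the minimum in the sample is compared: its image has size `ℓ`, so its
-- degree in `H` is at least `δ ℓ H`. As `p` depends on `φ`, typicality must cover all sets.
δ-transfer : ∀ {k m n ℓ j} (e′ : ℕ) .{{_ : NonZero n}} (H : KGraph k n) {b} →
  suc b ≡ (3 + 3 * e′) * (3 + 3 * e′) →
  2 * (suc m ^ k * b ^ (m ∸ k)) < suc b ^ (m ∸ k) → k * suc e′ ≤ m → 2 * (m * m) < n →
  ℓ ≤ m → ℓ + j ≡ k → {F : Family k} → Free F H →
  ∃[ H′ ] Free {n = m} F H′ ×
    suc e′ * (m ^ j * (j ! * δ ℓ H)) ≤ suc e′ * (n ^ j * (j ! * δ ℓ H′)) + 2 * j * (m ^ j * n ^ j)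
δ-transfer {k} {m} {n} {ℓ} {j} e′ H 1+b≡Q² large-m k*e≤m large-n ℓ≤m eq free =
  let φ , inj , typical   = T.∃-typical 1+b≡Q² large-m large-n
      p , ∣p∣≡ℓ , δ≡deg = δ-attained {ℓ = ℓ} (pullback H φ inj) ℓ≤m
  in pullback H φ inj , pullback-free {H = H} φ inj free , bound φ inj typical p ∣p∣≡ℓ δ≡deg
  where
  open ≤-Reasoning
  module T = Transfer {k} {m} {n} e′ H
  e = suc e′
  error = 2 * j * (m ^ j * n ^ j)

  bound : ∀ φ (inj : Injective _≡_ _≡_ (lookup φ)) → T.Typical φ →
    ∀ p → ∣ p ∣ ≡ ℓ → δ ℓ (pullback H φ inj) ≡ deg (pullback H φ inj) p →
    e * (m ^ j * (j ! * δ ℓ H)) ≤ e * (n ^ j * (j ! * δ ℓ (pullback H φ inj))) + error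
  bound φ inj typical p ∣p∣≡ℓ δ≡deg = begin
    e * (m ^ j * (j ! * δ ℓ H))            ≤⟨ *-monoʳ-≤ e (*-monoʳ-≤ (m ^ j) (*-monoʳ-≤ (j !) (δ≤deg H A ∣A∣≡ℓ))) ⟩
    e * (m ^ j * (j ! * deg H A))          ≡⟨ cong (λ x → e * (m ^ j * x)) (ext≡deg H j A (trans (cong (_+ j) ∣A∣≡ℓ) eq)) ⟨
    e * (m ^ j * ext H j A)                ≤⟨ T.transfer k*e≤m φ inj typical j p ∣p∣+j ⟩
    e * (n ^ j * ext H′ j p) + error       ≡⟨ cong (λ x → e * (n ^ j * x) + error) (trans (ext≡deg H′ j p ∣p∣+j) (cong (j ! *_) (sym δ≡deg))) ⟩
    e * (n ^ j * (j ! * δ ℓ H′)) + error   ∎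
    where
    A = img p φ
    H′ = pullback H φ inj
    ∣A∣≡ℓ : ∣ A ∣ ≡ ℓ
    ∣A∣≡ℓ = trans (∣img∣ φ inj p) ∣p∣≡ℓ
    ∣p∣+j : ∣ p ∣ + j ≡ k
    ∣p∣+j = trans (cong (_+ j) ∣p∣≡ℓ) eq

-- Binomial coefficients against powers

j!*nCj≡nP′j : ∀ {n j} → j ≤ n → j ! * (n C j) ≡ n P′ j
j!*nCj≡nP′j {n} {j} j≤n = trans (cong (j ! *_) (trans (nCk≡nPk/k! j≤n) (cong (λ p → (p / j !) {{j !≢0}}) nPj≡nP′j)))
  (m*[n/m]≡n {{j !≢0}} (k!∣nP′k j≤n))
  where
  nPj≡nP′j : n P j ≡ n P′ j
  nPj≡nP′j with j ≤ᵇ n in eq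
  ... | true  = refl
  ... | false = contradiction (≤⇒≤ᵇ j≤n) (subst T eq)

nP′j≤n^j : ∀ n j → n P′ j ≤ n ^ j
nP′j≤n^j n zero    = ≤-refl
nP′j≤n^j n (suc j) = *-mono-≤ (m∸n≤m n j) (nP′j≤n^j n j)

nP′j>0 : ∀ {n j} → j ≤ n → 0 < n P′ j
nP′j>0 {j = zero}  _   = s≤s z≤n
nP′j>0 {j = suc j} j<n = *-mono-≤ (m<n⇒0<n∸m j<n) (nP′j>0 (<⇒≤ j<n))

-- The new factor `n - j` loses a fraction `j / n`, at most `1 / 2e` once `n ≥ 2ej`; the induction,
-- run at accuracy `2e`, loses the other half.
n^j≲nP′j : ∀ j e → ∃[ n₀ ] ∀ n → n₀ ≤ n → e * n ^ j ≤ e * (n P′ j) + n ^ j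
n^j≲nP′j zero    e = 0 , λ n _ → m≤m+n (e * 1) 1
n^j≲nP′j (suc j) e with n^j≲nP′j j (2 * e)
... | n₁ , close = n₁ + (j + 2 * e * j) , λ n n₀≤n →
    step n (n ∸ j) (m+[n∸m]≡n (≤-trans (≤-trans (m≤m+n j _) (m≤n+m _ n₁)) n₀≤n))
      (close n (≤-trans (m≤m+n n₁ _) n₀≤n)) (≤-trans (≤-trans (m≤n+m _ j) (m≤n+m _ n₁)) n₀≤n)
  where
  open ≤-Reasoning
  step : ∀ n d → j + d ≡ n → 2 * e * n ^ j ≤ 2 * e * (n P′ j) + n ^ j → 2 * e * j ≤ n →
    e * n ^ suc j ≤ e * (d * (n P′ j)) + n ^ suc j
  step n d j+d≡n close 2ej≤n = *-cancelˡ-≤ 2 (begin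
    2 * (e * (n * n ^ j))                            ≡⟨ pull e n (n ^ j) ⟩
    n * (2 * e * n ^ j)                              ≤⟨ *-monoʳ-≤ n close ⟩
    n * (2 * e * (n P′ j) + n ^ j)                     ≡⟨ *-distribˡ-+ n (2 * e * (n P′ j)) (n ^ j) ⟩
    n * (2 * e * (n P′ j)) + n * n ^ j                 ≡⟨ cong (λ x → x * (2 * e * (n P′ j)) + n * n ^ j) j+d≡n ⟨
    (j + d) * (2 * e * (n P′ j)) + n * n ^ j           ≡⟨ split j d e ((n P′ j)) (n * n ^ j) ⟩
    2 * e * j * (n P′ j) + 2 * (e * (d * (n P′ j))) + n * n ^ j
      ≤⟨ +-monoˡ-≤ (n * n ^ j) (+-monoˡ-≤ (2 * (e * (d * (n P′ j)))) (*-mono-≤ 2ej≤n (nP′j≤n^j n j))) ⟩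
    n * n ^ j + 2 * (e * (d * (n P′ j))) + n * n ^ j   ≡⟨ collect (n * n ^ j) (e * (d * (n P′ j))) ⟩
    2 * (e * (d * (n P′ j)) + n * n ^ j)               ∎)
    where
    pull : ∀ e n p → 2 * (e * (n * p)) ≡ n * (2 * e * p)
    pull = solve-∀
    split : ∀ j d e p q → (j + d) * (2 * e * p) + q ≡ 2 * e * j * p + 2 * (e * (d * p)) + q
    split = solve-∀
    collect : ∀ a b → a + 2 * b + a ≡ 2 * (b + a)
    collect = solve-∀

-- From x / N ≤ y / K + c / e to x / J ≤ y / I + (c + 1) / e, where I ≤ K and J is
-- within a factor 1 ± 1 / e of N.
change-denominators : ∀ e c {x y I J K N} .{{_ : NonZero K}} .{{_ : NonZero N}} →
  e * (K * x) ≤ e * (N * y) + c * (K * N) → I ≤ K → e * N ≤ e * J + N → x ≤ J → J ≤ N →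
  e * (x * I) ≤ e * (y * J) + suc c * (I * J)
change-denominators e c {x} {y} {I} {J} {K} {N} xy I≤K NJ x≤J J≤N = *-cancelʳ-≤ _ _ N (begin
  e * (x * I) * N                                ≡⟨ pull e x I N ⟩
  x * I * (e * N)                                ≤⟨ *-monoʳ-≤ (x * I) NJ ⟩
  x * I * (e * J + N)                            ≡⟨ split x I e J N ⟩
  e * (x * I * J) + x * (I * N)                  ≤⟨ +-mono-≤ exIJ (*-monoˡ-≤ (I * N) x≤J) ⟩
  e * (N * y * J) + c * (N * I * J) + J * (I * N) ≡⟨ collect e N y J c I ⟩
  (e * (y * J) + suc c * (I * J)) * N            ∎)
  where
  open ≤-Reasoning
  pull : ∀ e x I N → e * (x * I) * N ≡ x * I * (e * N)
  pull = solve-∀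
  split : ∀ x I e J N → x * I * (e * J + N) ≡ e * (x * I * J) + x * (I * N)
  split = solve-∀
  collect : ∀ e N y J c I → e * (N * y * J) + c * (N * I * J) + J * (I * N) ≡ (e * (y * J) + suc c * (I * J)) * N
  collect = solve-∀

  exIJ : e * (x * I * J) ≤ e * (N * y * J) + c * (N * I * J)
  exIJ = *-cancelˡ-≤ K (begin
    K * (e * (x * I * J))                             ≡⟨ pullK K e x I J ⟩
    e * (K * x) * (I * J)                             ≤⟨ *-monoˡ-≤ (I * J) xy ⟩
    (e * (N * y) + c * (K * N)) * (I * J)             ≡⟨ splitK e N y c K I J ⟩
    e * (N * y * J) * I + c * (K * N) * (I * J)       ≤⟨ +-monoˡ-≤ _ (*-monoʳ-≤ (e * (N * y * J)) I≤K) ⟩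
    e * (N * y * J) * K + c * (K * N) * (I * J)       ≡⟨ collectK e N y J K c I ⟩
    K * (e * (N * y * J) + c * (N * I * J))           ∎)
    where
    pullK : ∀ K e x I J → K * (e * (x * I * J)) ≡ e * (K * x) * (I * J)
    pullK = solve-∀
    splitK : ∀ e N y c K I J → (e * (N * y) + c * (K * N)) * (I * J) ≡ e * (N * y * J) * I + c * (K * N) * (I * J)
    splitK = solve-∀
    collectK : ∀ e N y J K c I → e * (N * y * J) * K + c * (K * N) * (I * J) ≡ K * (e * (N * y * J) + c * (N * I * J))
    collectK = solve-∀

-- Comparing extremal numbers on `m` and `n` vertices

IsEx-transfer : ∀ {k m n ℓ j} e′ {b} {F : Family k} {v w} →
  suc b ≡ (3 + 3 * e′) * (3 + 3 * e′) →
  2 * (suc m ^ k * b ^ (m ∸ k)) < suc b ^ (m ∸ k) → k * suc e′ ≤ m → 2 * (m * m) < n →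
  k ≤ m → k ≤ n → ℓ + j ≡ k → suc e′ * n ^ j ≤ suc e′ * (n P′ j) + n ^ j →
  IsEx ℓ F m v → IsEx ℓ F n w → w ≤ n C j →
  suc e′ * (w * (m C j)) ≤ suc e′ * (v * (n C j)) + suc (2 * j) * ((m C j) * (n C j))
IsEx-transfer e′ _ _ _ _ _ _ _ _ _ (inj₂ (_ , refl)) _ = ≤-trans (≤-reflexive (*-zeroʳ (suc e′))) z≤n
IsEx-transfer {k} {m} {n} {ℓ} {j} e′ {F = F} {v} {w} 1+b≡Q² large-m k*e≤m large-n k≤m k≤n ℓ+j≡k close
  ex-m (inj₁ ((H , free , δ≡w) , _)) w≤ =
    let H′ , free′ , transferred = δ-transfer e′ {{n≢0}} H 1+b≡Q² large-m k*e≤m large-n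
          (≤-trans (m≤m+n ℓ j) (≤-trans (≤-reflexive ℓ+j≡k) k≤m)) ℓ+j≡k free
    in clear-factorials (subst (λ w → e * (m ^ j * (j ! * w)) ≤ e * (n ^ j * (j ! * v)) + 2 * j * (m ^ j * n ^ j)) δ≡w
         (≤-trans transferred (+-monoˡ-≤ _ (*-monoʳ-≤ e (*-monoʳ-≤ (n ^ j) (*-monoʳ-≤ (j !) (maximal ex-m H′ free′)))))))
  where
  open ≤-Reasoning
  e = suc e′

  n≢0 : NonZero n
  n≢0 = >-nonZero (≤-<-trans z≤n large-n)

  j≤k : j ≤ k
  j≤k = ≤-trans (m≤n+m j ℓ) (≤-reflexive ℓ+j≡k)

  maximal : IsEx ℓ F m v → ∀ (H : KGraph k m) → Free F H → δ ℓ H ≤ v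
  maximal (inj₁ (_ , bound)) H free = bound H free
  -- Impossible, since the sample itself is an `F`-free graph on `m` vertices.
  maximal (inj₂ (none , _))  H free = contradiction free (none H)

  pull : ∀ a e d c → a * a * (e * (d * c)) ≡ e * (a * d * (a * c))
  pull = solve-∀
  collect : ∀ a e v c s d → e * (a * v * (a * c)) + s * (a * d * (a * c)) ≡ a * a * (e * (v * c) + s * (d * c))
  collect = solve-∀

  m^j≢0 : j ≤ m → NonZero (m ^ j)
  m^j≢0 j≤m = >-nonZero (≤-trans (nP′j>0 j≤m) (nP′j≤n^j m j))

  clear-factorials : e * (m ^ j * (j ! * w)) ≤ e * (n ^ j * (j ! * v)) + 2 * j * (m ^ j * n ^ j) →
    e * (w * (m C j)) ≤ e * (v * (n C j)) + suc (2 * j) * ((m C j) * (n C j))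
  clear-factorials le = *-cancelˡ-≤ (j ! * j !) {{m*n≢0 (j !) (j !) {{j !≢0}} {{j !≢0}}}} (begin
    j ! * j ! * (e * (w * (m C j)))            ≡⟨ pull (j !) e w (m C j) ⟩
    e * (j ! * w * (j ! * (m C j)))
      -- Passing from powers to binomials costs one more `1 / e`, hence `suc (2 * j)`.
      ≤⟨ change-denominators e (2 * j) {{m^j≢0 (≤-trans j≤k k≤m)}} {{m^n≢0 n j {{n≢0}}}} le
           (≤-trans (≤-reflexive (j!*nCj≡nP′j (≤-trans j≤k k≤m))) (nP′j≤n^j m j))
           (subst (λ p → e * n ^ j ≤ e * p + n ^ j) (sym (j!*nCj≡nP′j (≤-trans j≤k k≤n))) close)
           (*-monoʳ-≤ (j !) w≤)
           (≤-trans (≤-reflexive (j!*nCj≡nP′j (≤-trans j≤k k≤n))) (nP′j≤n^j n j)) ⟩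
    e * (j ! * v * (j ! * (n C j))) + suc (2 * j) * (j ! * (m C j) * (j ! * (n C j)))
      ≡⟨ collect (j !) e v (n C j) (suc (2 * j)) (m C j) ⟩
    j ! * j ! * (e * (v * (n C j)) + suc (2 * j) * ((m C j) * (n C j))) ∎)

ex-transfer : ∀ (em : ExcludedMiddle 0ℓ) k ℓ → ℓ ≤ k → (F : Family k) (e′ : ℕ) → let j = k ∸ ℓ in
  ∃[ m₀ ] ∀ m → m₀ ≤ m → ∃[ n₀ ] ∀ n → n₀ ≤ n →
    suc e′ * (ex em ℓ F n * (m C j)) ≤ suc e′ * (ex em ℓ F m * (n C j)) + suc (2 * j) * ((m C j) * (n C j))
ex-transfer em k ℓ ℓ≤k F e′ =
  -- This is `Q² - 1` for `Q = 3 + 3 * e′`, expanded to avoid subtraction.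
  let b          = 8 + (18 * e′ + 9 * (e′ * e′))
      m₁ , large = eventually-rare k b
      n₁ , close = n^j≲nP′j (k ∸ ℓ) (suc e′)
  in m₁ + (k * suc e′ + k) , λ m m₀≤m →
     suc (2 * (m * m)) + (n₁ + k) , λ n n₀≤n →
     IsEx-transfer e′ {b} (1+b≡Q² e′)
       (large m (≤-trans (m≤m+n m₁ _) m₀≤m))
       (≤-trans (≤-trans (m≤m+n (k * suc e′) _) (m≤n+m _ m₁)) m₀≤m)
       (≤-trans (m≤m+n _ (n₁ + k)) n₀≤n)
       (≤-trans (≤-trans (m≤n+m k (k * suc e′)) (m≤n+m _ m₁)) m₀≤m)
       (≤-trans (≤-trans (m≤n+m k n₁) (m≤n+m _ (suc (2 * (m * m))))) n₀≤n)
       (m+[n∸m]≡n ℓ≤k)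
       (close n (≤-trans (≤-trans (m≤m+n n₁ k) (m≤n+m _ (suc (2 * (m * m))))) n₀≤n))
       (proj₂ (∃-IsEx em ℓ F m)) (proj₂ (∃-IsEx em ℓ F n)) (ex≤ em ℓ F n)
  where
  1+b≡Q² : ∀ e′ → suc (8 + (18 * e′ + 9 * (e′ * e′))) ≡ (3 + 3 * e′) * (3 + 3 * e′)
  1+b≡Q² = solve-∀

-- Rational inequalities and convergence

÷≤÷+÷ : ∀ {w v c J I e} .{{_ : NonZero J}} .{{_ : NonZero I}} .{{_ : NonZero e}} →
  e * (w * I) ≤ e * (v * J) + c * (I * J) → w ÷ J ℚ.≤ (v ÷ I) ℚ.+ (c ÷ e)
÷≤÷+÷ {w} {v} {c} {J@(suc J′)} {I@(suc I′)} {e@(suc e′)} le = ℚ.toℚᵘ-cancel-≤ (begin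
  ℚ.toℚᵘ (w ÷ J)                               ≃⟨ ℚ.toℚᵘ-fromℚᵘ (ℚᵘ.mkℚᵘ (pos w) J′) ⟩
  ℚᵘ.mkℚᵘ (pos w) J′                           ≤⟨ ℚᵘ.*≤* cross ⟩
  ℚᵘ.mkℚᵘ (pos v) I′ ℚᵘ.+ ℚᵘ.mkℚᵘ (pos c) e′   ≃⟨ ℚᵘ.+-cong (ℚ.toℚᵘ-fromℚᵘ (ℚᵘ.mkℚᵘ (pos v) I′)) (ℚ.toℚᵘ-fromℚᵘ (ℚᵘ.mkℚᵘ (pos c) e′)) ⟨
  ℚ.toℚᵘ (v ÷ I) ℚᵘ.+ ℚ.toℚᵘ (c ÷ e)           ≃⟨ ℚ.toℚᵘ-homo-+ (v ÷ I) (c ÷ e) ⟨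
  ℚ.toℚᵘ ((v ÷ I) ℚ.+ (c ÷ e))                 ∎)
  where
  open ℚᵘ.≤-Reasoning
  rotateˡ : ∀ w I e → w * (I * e) ≡ e * (w * I)
  rotateˡ = solve-∀
  rotateʳ : ∀ e v J c I → e * (v * J) + c * (I * J) ≡ (v * e + c * I) * J
  rotateʳ = solve-∀
  crossℕ : w * (I * e) ≤ (v * e + c * I) * J
  crossℕ = ≤-trans (≤-reflexive (rotateˡ w I e)) (≤-trans le (≤-reflexive (rotateʳ e v J c I)))
  cross : pos w ℤ.* pos (I * e) ℤ.≤ (pos v ℤ.* pos e ℤ.+ pos c ℤ.* pos I) ℤ.* pos J
  cross = subst₂ ℤ._≤_ (ℤ.pos-* w (I * e))
    (trans (ℤ.pos-* (v * e + c * I) J) (cong (ℤ._* pos J) (trans (ℤ.pos-+ (v * e) (c * I)) (cong₂ ℤ._+_ (ℤ.pos-* v e) (ℤ.pos-* c I)))))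
    (+≤+ crossℕ)

archimedean : ∀ c {ε} → 0ℚ ℚ.< ε → ∃[ e′ ] c ÷ suc e′ ℚ.≤ ε
archimedean c {mkℚ ℤ.-[1+ _ ] _ _} (ℚ.*<* ())
archimedean c {mkℚ (pos 0) _ _}      (ℚ.*<* (ℤ.+<+ ()))
-- Here `ε ≥ 1 / (d + 1)`, and the denominator `c (d + 1) + 1` brings the quotient below that.
archimedean c {ε@(mkℚ (pos (suc a)) d _)} _ = c * suc d , ℚ.toℚᵘ-cancel-≤ (begin
  ℚ.toℚᵘ (c ÷ suc (c * suc d))   ≃⟨ ℚ.toℚᵘ-fromℚᵘ (ℚᵘ.mkℚᵘ (pos c) (c * suc d)) ⟩
  ℚᵘ.mkℚᵘ (pos c) (c * suc d)    ≤⟨ ℚᵘ.*≤* (subst₂ ℤ._≤_ (ℤ.pos-* c (suc d)) (ℤ.pos-* (suc a) (suc (c * suc d)))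
                                      (+≤+ (≤-trans (n≤1+n _) (m≤m+n _ _)))) ⟩
  ℚᵘ.mkℚᵘ (pos (suc a)) d        ∎)
  where open ℚᵘ.≤-Reasoning

halve : ∀ {ε} → 0ℚ ℚ.< ε → ∃[ η ] 0ℚ ℚ.< η × η ℚ.+ η ℚ.< ε
halve {ε} 0<ε = let θ , 0<θ , θ<ε = ℚ.<-dense 0<ε in
  ½ ℚ.* θ , ℚ.positive⁻¹ _ {{ℚ.pos*pos⇒pos ½ θ {{ℚ.positive 0<θ}}}} ,
  subst (ℚ._< ε) (sym (trans (sym (ℚ.*-distribʳ-+ θ ½ ½)) (ℚ.*-identityˡ θ))) θ<ε

p<q+r⇒p-r<q : ∀ {p q} r → p ℚ.< q ℚ.+ r → p ℚ.- r ℚ.< q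
p<q+r⇒p-r<q {p} {q} r lt = subst (p ℚ.- r ℚ.<_)
  (trans (ℚ.+-assoc q r (ℚ.- r)) (trans (cong (q ℚ.+_) (ℚ.+-inverseʳ r)) (ℚ.+-identityʳ q)))
  (ℚ.+-monoˡ-< (ℚ.- r) lt)

-- A substitute for monotonicity. As `n₀` depends on `m`, it looks weaker than the Cauchy condition,
-- yet bounded sequences with it converge.
EventuallyBelow : (ℕ → ℚ) → Set
EventuallyBelow a = ∀ ε → 0ℚ ℚ.< ε → ∃[ m₀ ] ∀ m → m₀ ≤ m → ∃[ n₀ ] ∀ n → n₀ ≤ n → a n ℚ.≤ a m ℚ.+ ε

module _ (em : ExcludedMiddle 0ℓ) (a : ℕ → ℚ) (-1<a : ∀ n → ℚ.- 1ℚ ℚ.< a n) (a≤1 : ∀ n → a n ℚ.≤ 1ℚ) where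

  -- An approximate minimiser of the tail stands in for its infimum, which need be neither rational
  -- nor attained.
  almost-minimal : ∀ {η} → 0ℚ ℚ.< η → ∀ m₀ → ∃[ p ] m₀ ≤ p × (∀ q → m₀ ≤ q → a p ℚ.≤ a q ℚ.+ η)
  -- The fuel `2e` is the length 2 of `(-1, 1]` cut into steps of `1 / e ≤ η`.
  almost-minimal {η} 0<η m₀ = descend (2 * suc e′) m₀ ≤-refl (ℚ.≤-trans (a≤1 m₀) start)
    where
    e′ = proj₁ (archimedean 1 0<η)
    e = suc e′

    -- Every term lies above -1, so only finitely many descents by 1 / e are possible.
    descend : ∀ f p → m₀ ≤ p → a p ℚ.≤ ℚ.- 1ℚ ℚ.+ (f ÷ e) → ∃[ p ] m₀ ≤ p × (∀ q → m₀ ≤ q → a p ℚ.≤ a q ℚ.+ η)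
    descend f p m₀≤p ap≤ with em {∃[ q ] m₀ ≤ q × a q ℚ.+ η ℚ.< a p}
    ... | no ¬lower = p , m₀≤p , λ q m₀≤q → ℚ.≮⇒≥ λ lt → ¬lower (q , m₀≤q , lt)
    descend zero    p m₀≤p ap≤ | yes _ = contradiction
      (ℚ.<-≤-trans (-1<a p) (ℚ.≤-trans ap≤ (ℚ.≤-reflexive (trans (cong (ℚ.- 1ℚ ℚ.+_) (ℚ.0/n≡0 e)) (ℚ.+-identityʳ (ℚ.- 1ℚ))))))
      (ℚ.<-irrefl refl)
    descend (suc f) p m₀≤p ap≤ | yes (q , m₀≤q , lt) = descend f q m₀≤q (ℚ.<⇒≤ (ℚ.<-≤-trans (q<p-η lt) below))
      where
      q<p-η : a q ℚ.+ η ℚ.< a p → a q ℚ.< a p ℚ.- η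
      q<p-η lt = subst (ℚ._< a p ℚ.- η)
        (trans (ℚ.+-assoc (a q) η (ℚ.- η)) (trans (cong (a q ℚ.+_) (ℚ.+-inverseʳ η)) (ℚ.+-identityʳ (a q))))
        (ℚ.+-monoˡ-< (ℚ.- η) lt)
      unit : ∀ e f → e * (suc f * e) ≡ e * (f * e) + 1 * (e * e)
      unit = solve-∀
      suc-f : suc f ÷ e ℚ.≤ (f ÷ e) ℚ.+ η
      suc-f = ℚ.≤-trans (÷≤÷+÷ {suc f} {f} {1} {e} {e} {e} (≤-reflexive (unit e f))) (ℚ.+-monoʳ-≤ (f ÷ e) (proj₂ (archimedean 1 0<η)))
      below : a p ℚ.- η ℚ.≤ ℚ.- 1ℚ ℚ.+ (f ÷ e)
      below = ℚ.≤-trans (ℚ.+-monoˡ-≤ (ℚ.- η) (ℚ.≤-trans ap≤ (ℚ.≤-trans (ℚ.+-monoʳ-≤ (ℚ.- 1ℚ) suc-f)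
          (ℚ.≤-reflexive (sym (ℚ.+-assoc (ℚ.- 1ℚ) (f ÷ e) η))))))
        (ℚ.≤-reflexive (trans (ℚ.+-assoc (ℚ.- 1ℚ ℚ.+ (f ÷ e)) η (ℚ.- η))
          (trans (cong ((ℚ.- 1ℚ ℚ.+ (f ÷ e)) ℚ.+_) (ℚ.+-inverseʳ η)) (ℚ.+-identityʳ _))))

    start : 1ℚ ℚ.≤ ℚ.- 1ℚ ℚ.+ ((2 * e) ÷ e)
    start = ℚ.+-monoʳ-≤ (ℚ.- 1ℚ) (ℚ.≤-trans (÷≤÷+÷ {2} {2 * e} {0} {1} {e} {1} (≤-reflexive (identity e)))
      (ℚ.≤-reflexive (ℚ.+-identityʳ ((2 * e) ÷ e))))
      where
      identity : ∀ e → 1 * (2 * e) ≡ 1 * (2 * e * 1) + 0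
      identity = solve-∀

  -- Upper side: past `m₀`, each `a n` bounds all late terms up to `η`. Lower side: for large `n`,
  -- `a n ≤ a p + η ≤ a q + 2η` for all `q ≥ m₀`, so every tail reaches above `a n - ε`.
  eventuallyBelow⇒⟶limsup : EventuallyBelow a → a ⟶ limsup em a (ℚ.- 1ℚ) 1ℚ -1<a a≤1
  eventuallyBelow⇒⟶limsup below ε 0<ε with halve 0<ε
  ... | η , 0<η , 2η<ε with below η 0<η
  ... | m₀ , bounded with almost-minimal 0<η m₀
  ... | p , m₀≤p , minimal with bounded p m₀≤p
  ... | n₁ , bounded-p = m₀ + n₁ , λ n N≤n →
      lower-side n (≤-trans (m≤n+m n₁ m₀) N≤n) , upper-side n (≤-trans (m≤m+n m₀ n₁) N≤n)
    where
    η<ε : η ℚ.< ε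
    η<ε = ℚ.<-trans (subst (ℚ._< η ℚ.+ η) (ℚ.+-identityʳ η) (ℚ.+-monoʳ-< η 0<η)) 2η<ε

    upper-side : ∀ n → m₀ ≤ n → upper (limsup em a (ℚ.- 1ℚ) 1ℚ -1<a a≤1) (a n ℚ.+ ε)
    upper-side n m₀≤n = let n₀ , bounded-n = bounded n m₀≤n in
      n₀ , a n ℚ.+ η , ℚ.+-monoʳ-< (a n) η<ε , λ i → bounded-n (n₀ + i) (m≤m+n n₀ i)

    lower-side : ∀ n → n₁ ≤ n → lower (limsup em a (ℚ.- 1ℚ) 1ℚ -1<a a≤1) (a n ℚ.- ε)
    -- `lower` of an `inf` asks for one rational strictly above `a n - ε` and below every tail
    -- supremum; `a n - θ` provides it.
    lower-side n n₁≤n = let θ , 2η<θ , θ<ε = ℚ.<-dense 2η<ε in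
      a n ℚ.- θ , ℚ.+-monoʳ-< (a n) (ℚ.neg-antimono-< θ<ε) , λ N → m₀ ,
      p<q+r⇒p-r<q θ (ℚ.≤-<-trans
        (ℚ.≤-trans (bounded-p n n₁≤n) (ℚ.≤-trans (ℚ.+-monoˡ-≤ η (minimal (N + m₀) (m≤n+m m₀ N)))
          (ℚ.≤-reflexive (ℚ.+-assoc (a (N + m₀)) η η))))
        (ℚ.+-monoʳ-< (a (N + m₀)) 2η<θ))

0≤÷ : ∀ w d → 0ℚ ℚ.≤ w ÷ d
0≤÷ w zero    = ℚ.≤-refl
0≤÷ w (suc d) = ℚ.nonNegative⁻¹ (pos w ℚ./ suc d) {{ℚ.normalize-nonNeg w (suc d)}}

÷≤1 : ∀ {w d} → w ≤ d → w ÷ d ℚ.≤ 1ℚ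
÷≤1 {w} {zero}  _   = ℚ.nonNegative⁻¹ 1ℚ
÷≤1 {w} {suc d} w≤d = ÷≤÷+÷ {w} {1} {0} {suc d} {1} {1} (≤-trans (≤-reflexive (identity w)) (+-monoˡ-≤ 0 (+-monoˡ-≤ 0 (+-monoˡ-≤ 0 w≤d))))
  where
  identity : ∀ w → 1 * (w * 1) ≡ w + 0 + 0 + 0
  identity = solve-∀

-- Densities of extremal numbers

nCj≢0 : ∀ {n j} → j ≤ n → NonZero (n C j)
nCj≢0 {n} {j} j≤n = m*n≢0⇒n≢0 (j !) {{>-nonZero (subst (0 <_) (sym (j!*nCj≡nP′j j≤n)) (nP′j>0 j≤n))}}

density-eventuallyBelow : ∀ (em : ExcludedMiddle 0ℓ) k ℓ → ℓ ≤ k → (F : Family k) → EventuallyBelow (density em ℓ F)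
density-eventuallyBelow em k ℓ ℓ≤k F ε 0<ε =
  let j             = k ∸ ℓ
      c             = suc (2 * j)
      e′ , c/e≤ε    = archimedean c 0<ε
      m₀ , transfer = ex-transfer em k ℓ ℓ≤k F e′
  -- Adding `j`, here and to `n₀`, makes the binomials nonzero, so that `÷` is true division and not
  -- its default 0.
  in m₀ + j , λ m m₀≤m →
     let n₀ , transfer-m = transfer m (≤-trans (m≤m+n m₀ j) m₀≤m)
     in n₀ + j , λ n n₀≤n → ℚ.≤-trans
       (÷≤÷+÷ {ex em ℓ F n} {ex em ℓ F m} {c} {n C j} {m C j} {suc e′}
         {{nCj≢0 (≤-trans (m≤n+m j n₀) n₀≤n)}} {{nCj≢0 (≤-trans (m≤n+m j m₀) m₀≤m)}}
         (transfer-m n (≤-trans (m≤m+n n₀ j) n₀≤n)))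
       (ℚ.+-monoʳ-≤ (density em ℓ F m) c/e≤ε)

proposition1p5 : (em : ExcludedMiddle 0ℓ) (k ℓ : ℕ) → ℓ < k →
    (F : Family k) → ∃[ L ] (density em ℓ F ⟶ L) × (π em ℓ F ≈ L)
proposition1p5 em k ℓ ℓ<k F = π em ℓ F ,
  -- `lower` and `upper` of a `limsup` compute to statements about the sequence alone, so the bounds
  -- given here can stand in for those inside `π`.
  eventuallyBelow⇒⟶limsup em (density em ℓ F)
    (λ n → ℚ.<-≤-trans (ℚ.negative⁻¹ (ℚ.- 1ℚ)) (0≤÷ (ex em ℓ F n) (n C (k ∸ ℓ))))
    (λ n → ÷≤1 (ex≤ em ℓ F n))
    (density-eventuallyBelow em k ℓ (<⇒≤ ℓ<k) F) ,
  λ q → mk⇔ id id , mk⇔ id id
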